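{- Let $n\geq 4$ and $2\leq m\leq n-2$. Then $\kappa(Q_n;C_{2^m})=n-m$ if $n\in\{4,5\}$ or if $m=2$; and if $n\geq 6$ and $3\leq m\leq n-2$, then $\kappa(Q_n;C_{2^m})=\lceil\frac{n}{2^{m-1}}\rceil<n-m$.
   Context: $Q_n$ is the $n$-dimensional hypercube: its vertices are the binary strings of length $n$, two vertices being adjacent iff they differ in exactly one position. $C_k$ denotes the cycle of length $k$. For connected graphs $G,H$, an $H$-structure cut of $G$ is a set $F$ of subgraphs of $G$, each isomorphic to $H$, such that $G-V(F)$ is disconnected or trivial (a single vertex); $\kappa(G;H)$ is the minimum cardinality of an $H$-structure cut of $G$. -}

module Defs where

open import Data.Nat using (ℕ; zero; suc; _+_; _∸_; _^_; _≤_; _<_)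
open import Data.Nat.DivMod using (_/_)
open import Data.Nat.Properties using (m^n≢0)
open import Data.Bool using (Bool; true; false)
open import Data.Vec using (Vec; []; _∷_)
open import Data.List using (List; length)
open import Data.List.Relation.Unary.Any using (Any)
open import Data.Product using (Σ; _×_; ∃)
open import Data.Sum using (_⊎_)
open import Relation.Binary.PropositionalEquality using (_≡_)
open import Relation.Nullary using (¬_)

Vertex : ℕ → Set
Vertex n = Vec Bool n

hamming : ∀ {n} → Vertex n → Vertex n → ℕ
hamming [] [] = 0
hamming (false ∷ x) (false ∷ y) = hamming x y
hamming (true ∷ x) (true ∷ y) = hamming x y
hamming (false ∷ x) (true ∷ y) = suc (hamming x y)
hamming (true ∷ x) (false ∷ y) = suc (hamming x y)

Adj : ∀ {n} → Vertex n → Vertex n → Set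
Adj x y = hamming x y ≡ 1

-- A subgraph of Q_n isomorphic to the cycle C_k (k ≥ 3), given by a cyclic
-- sequence of k pairwise distinct vertices v 0, …, v (k-1) with consecutive
-- ones adjacent and v (k-1) adjacent to v 0.
record Cycle (n k : ℕ) : Set where
  field
    v        : ℕ → Vertex n
    distinct : ∀ i j → i < k → j < k → v i ≡ v j → i ≡ j
    adjStep  : ∀ i → suc i < k → Adj (v i) (v (suc i))
    adjClose : Adj (v (k ∸ 1)) (v 0)

InCycle : ∀ {n k} → Vertex n → Cycle n k → Set
InCycle {k = k} w C = ∃ λ i → i < k × Cycle.v C i ≡ w

InFamily : ∀ {n k} → Vertex n → List (Cycle n k) → Set
InFamily w F = Any (InCycle w) F

Remains : ∀ {n k} → List (Cycle n k) → Vertex n → Set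
Remains F w = ¬ InFamily w F

data Reach {n k} (F : List (Cycle n k)) : Vertex n → Vertex n → Set where
  here : ∀ {u} → Remains F u → Reach F u u
  step : ∀ {u w z} → Remains F u → Adj u w → Reach F w z → Reach F u z

Disconnected : ∀ {n k} → List (Cycle n k) → Set
Disconnected F = ∃ λ u → ∃ λ w → Remains F u × Remains F w × ¬ Reach F u w

Trivial : ∀ {n k} → List (Cycle n k) → Set
Trivial F = ∃ λ u → Remains F u × (∀ w → Remains F w → w ≡ u)

IsStructureCut : ∀ {n k} → List (Cycle n k) → Set
IsStructureCut F = Disconnected F ⊎ Trivial F

KappaEq : ℕ → ℕ → ℕ → Set
KappaEq n k c =
  (Σ (List (Cycle n k)) λ F → IsStructureCut F × length F ≡ c)
  × (∀ (F : List (Cycle n k)) → IsStructureCut F → c ≤ length F)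

ceilDivPow2 : ℕ → ℕ → ℕ
ceilDivPow2 a j = _/_ (a + 2 ^ j ∸ 1) (2 ^ j) {{m^n≢0 2 j}}

{-# OPTIONS --safe #-}

-- Upper bounds. The n - 2 squares obtained by shifting Q_2 along each further direction cut Q_2 off.
-- For m ≥ 3 it is cheaper to isolate a single vertex: a cycle of length 2h (h = 2^(m-1)) can pass through
-- min(h, n) of its n neighbours, since the neighbours can be joined in a zigzag through vertices of weight 2.
--
-- Lower bounds. If fewer than n - d faces of dimension ≤ d are removed from Q_n, the rest is connected:
-- split along the first direction; either both halves meet fewer faces, or all faces meet one half, in
-- which case those meeting the other half lose a dimension there. For d = 2 this settles the squares.
-- For m ≥ 3, suppose that h |F| < n, and let S be the set of at most 2(n - 1) removed vertices. By parity
-- S contains no full neighbourhood. Split along the direction of some edge of S. A vertex x that cannot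
-- escape to the other half within two steps, through a neighbour y say, would force the projection of S
-- to contain all 2(n - 1) neighbours of x and y, but projecting identifies the ends of the chosen edge.

module Submission where

open import Defs
open import Data.Bool using (Bool; true; false; not; _xor_)
import Data.Bool.Properties as Bool
open import Data.Empty using (⊥)
open import Data.Fin using (Fin; zero; suc; punchIn; punchOut; toℕ)
import Data.Fin.Properties as Fin
open import Data.List using (List; []; _∷_; _++_; length; map; tabulate; applyUpTo; upTo; allFin; take)
import Data.List.Membership.DecPropositional as DecMembership
open import Data.List.Membership.Propositional using (_∈_; _∉_; lose)
import Data.List.Membership.Propositional.Properties as ∈
import Data.List.Properties as List
open import Data.List.Relation.Unary.All using (All; []; _∷_)
import Data.List.Relation.Unary.All as All
import Data.List.Relation.Unary.All.Properties as All
open import Data.List.Relation.Unary.AllPairs using ([]; _∷_)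
open import Data.List.Relation.Unary.Any using (Any; here; there)
import Data.List.Relation.Unary.Any as Any
import Data.List.Relation.Unary.Any.Properties as Any
open import Data.List.Relation.Unary.Unique.Propositional using (Unique)
import Data.List.Relation.Unary.Unique.Propositional.Properties as Unique
open import Data.Maybe using (Maybe; just; nothing)
open import Data.Nat using (ℕ; zero; suc; pred; _+_; _*_; _∸_; _^_; _⊓_; _≤_; _<_; z≤n; s≤s; s≤s⁻¹; NonZero; >-nonZero⁻¹)
open import Data.Nat.DivMod using (_/_; _%_; m≡m%n+[m/n]*n; m%n<n; m<n*o⇒m/o<n; m/n*n≤m)
import Data.Nat.Properties as ℕ
open import Data.Nat.Tactic.RingSolver using (solve-∀)
open import Data.Product using (Σ; _×_; _,_; proj₁; proj₂; ∃)
open import Data.Sum using (_⊎_; inj₁; inj₂)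
open import Data.Vec using (Vec; []; _∷_; lookup; replicate; insertAt; removeAt; updateAt)
import Data.Vec.Properties as Vec
open import Function using (_∘_)
open import Relation.Binary.Definitions using (DecidableEquality)
open import Relation.Binary.PropositionalEquality
  using (_≡_; _≢_; refl; sym; trans; cong; cong₂; subst; subst₂)
open import Relation.Nullary using (¬_; Dec; yes; no; contradiction; _×-dec_; ¬?)

-- Decidable equality and counting in lists

_≟_ : ∀ {n} → DecidableEquality (Vertex n)
_≟_ = Vec.≡-dec Bool._≟_

module _ {a} {A : Set a} where

  delete : ∀ {x : A} {ys} → x ∈ ys →
    ∃ λ zs → length ys ≡ suc (length zs) × (∀ {y} → y ∈ ys → y ≢ x → y ∈ zs)
  delete {x} {_ ∷ ys} (here refl) = ys , refl , λ
    { (here refl) y≢x → contradiction refl y≢x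
    ; (there y∈ys) _ → y∈ys }
  delete {x} {y ∷ ys} (there x∈ys) with delete x∈ys
  ... | zs , eq , keep = y ∷ zs , cong suc eq , λ
    { (here refl) _ → here refl
    ; (there z∈ys) z≢x → there (keep z∈ys z≢x) }

  -- The pigeonhole principle behind every count of removed vertices: each element of `xs` uses up
  -- its own occurrence in `ys`, which `delete` takes out.
  unique⊆⇒length≤ : ∀ {xs ys : List A} → Unique xs → (∀ {x} → x ∈ xs → x ∈ ys) →
    length xs ≤ length ys
  unique⊆⇒length≤ [] _ = z≤n
  unique⊆⇒length≤ {x ∷ xs} (x∉xs ∷ u) sub with delete (sub (here refl))
  ... | zs , eq , keep rewrite eq =
    s≤s (unique⊆⇒length≤ u λ y∈xs → keep (sub (there y∈xs)) λ { refl → All.lookup x∉xs y∈xs refl })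

-- Distance, flips, parity and projections in the hypercube

hamming-refl : ∀ {n} (x : Vertex n) → hamming x x ≡ 0
hamming-refl [] = refl
hamming-refl (false ∷ x) = hamming-refl x
hamming-refl (true ∷ x) = hamming-refl x

hamming-sym : ∀ {n} (x y : Vertex n) → hamming x y ≡ hamming y x
hamming-sym [] [] = refl
hamming-sym (false ∷ x) (false ∷ y) = hamming-sym x y
hamming-sym (true ∷ x) (true ∷ y) = hamming-sym x y
hamming-sym (false ∷ x) (true ∷ y) = cong suc (hamming-sym x y)
hamming-sym (true ∷ x) (false ∷ y) = cong suc (hamming-sym x y)

hamming≡0⇒≡ : ∀ {n} (x y : Vertex n) → hamming x y ≡ 0 → x ≡ y
hamming≡0⇒≡ [] [] _ = refl
hamming≡0⇒≡ (false ∷ x) (false ∷ y) eq = cong (false ∷_) (hamming≡0⇒≡ x y eq)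
hamming≡0⇒≡ (true ∷ x) (true ∷ y) eq = cong (true ∷_) (hamming≡0⇒≡ x y eq)

hamming-∷ : ∀ b {n} (x y : Vertex n) → hamming (b ∷ x) (b ∷ y) ≡ hamming x y
hamming-∷ false x y = refl
hamming-∷ true x y = refl

adj-sym : ∀ {n} (x y : Vertex n) → Adj x y → Adj y x
adj-sym x y e = trans (hamming-sym y x) e

adj-∷ : ∀ b {n} (x y : Vertex n) → Adj x y → Adj (b ∷ x) (b ∷ y)
adj-∷ b x y e = trans (hamming-∷ b x y) e

flip : ∀ {n} → Fin n → Vertex n → Vertex n
flip i x = updateAt x i not

flip-involutive : ∀ {n} (i : Fin n) (x : Vertex n) → flip i (flip i x) ≡ x
flip-involutive zero (b ∷ x) = cong (_∷ x) (Bool.not-involutive b)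
flip-involutive (suc i) (b ∷ x) = cong (b ∷_) (flip-involutive i x)

adj-flip : ∀ {n} (i : Fin n) (x : Vertex n) → Adj x (flip i x)
adj-flip zero (false ∷ x) = cong suc (hamming-refl x)
adj-flip zero (true ∷ x) = cong suc (hamming-refl x)
adj-flip (suc i) (b ∷ x) = adj-∷ b x _ (adj-flip i x)

adj⇒flip : ∀ {n} (x y : Vertex n) → Adj x y → ∃ λ i → y ≡ flip i x
adj⇒flip [] [] ()
adj⇒flip (false ∷ x) (true ∷ y) e =
  zero , cong (true ∷_) (sym (hamming≡0⇒≡ x y (ℕ.suc-injective e)))
adj⇒flip (true ∷ x) (false ∷ y) e =
  zero , cong (false ∷_) (sym (hamming≡0⇒≡ x y (ℕ.suc-injective e)))
adj⇒flip (false ∷ x) (false ∷ y) e with adj⇒flip x y e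
... | i , refl = suc i , refl
adj⇒flip (true ∷ x) (true ∷ y) e with adj⇒flip x y e
... | i , refl = suc i , refl

flip-injective : ∀ {n} {i j : Fin n} (x : Vertex n) → flip i x ≡ flip j x → i ≡ j
flip-injective {i = zero} {zero} _ _ = refl
flip-injective {i = suc i} {suc j} (b ∷ x) eq =
  cong suc (flip-injective x (Vec.∷-injectiveʳ eq))
flip-injective {i = zero} {suc j} (b ∷ x) eq =
  contradiction (sym (Vec.∷-injectiveˡ eq)) (Bool.not-¬ refl)
flip-injective {i = suc i} {zero} (b ∷ x) eq =
  contradiction (Vec.∷-injectiveˡ eq) (Bool.not-¬ refl)

-- The bipartition of the hypercube.
parity : ∀ {n} → Vertex n → Bool
parity [] = false
parity (b ∷ x) = b xor parity x

parity-flip : ∀ {n} (i : Fin n) (x : Vertex n) → parity (flip i x) ≡ not (parity x)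
parity-flip zero (false ∷ x) = refl
parity-flip zero (true ∷ x) = sym (Bool.not-involutive (parity x))
parity-flip (suc i) (false ∷ x) = parity-flip i x
parity-flip (suc i) (true ∷ x) = cong not (parity-flip i x)

parity-adj : ∀ {n} (x y : Vertex n) → Adj x y → parity y ≡ not (parity x)
parity-adj x y e with adj⇒flip x y e
... | i , refl = parity-flip i x

insertAt-adj : ∀ {n} (i : Fin (suc n)) b (x y : Vertex n) → Adj x y →
  Adj (insertAt x i b) (insertAt y i b)
insertAt-adj zero b x y e = adj-∷ b x y e
insertAt-adj (suc i) b (false ∷ x) (false ∷ y) e = insertAt-adj i b x y e
insertAt-adj (suc i) b (true ∷ x) (true ∷ y) e = insertAt-adj i b x y e
insertAt-adj (suc i) b (false ∷ x) (true ∷ y) e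
  rewrite hamming≡0⇒≡ x y (ℕ.suc-injective e) = cong suc (hamming-refl (insertAt y i b))
insertAt-adj (suc i) b (true ∷ x) (false ∷ y) e
  rewrite hamming≡0⇒≡ x y (ℕ.suc-injective e) = cong suc (hamming-refl (insertAt y i b))

-- Projecting along direction `i` collapses the edges of that direction; by `removeAt-flip-punchIn`
-- all other edges stay edges.
removeAt-flip : ∀ {n} (i : Fin (suc n)) (x : Vertex (suc n)) →
  removeAt (flip i x) i ≡ removeAt x i
removeAt-flip zero (b ∷ x) = refl
removeAt-flip {suc n} (suc i) (b ∷ x@(_ ∷ _)) with flip i x | removeAt-flip i x
... | _ ∷ _ | eq = cong (b ∷_) eq

removeAt-flip-punchIn : ∀ {n} (i : Fin (suc n)) (k : Fin n) (x : Vertex (suc n)) →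
  removeAt (flip (punchIn i k) x) i ≡ flip k (removeAt x i)
removeAt-flip-punchIn zero k (b ∷ x) = refl
removeAt-flip-punchIn (suc i) zero (b ∷ x@(_ ∷ _)) = refl
removeAt-flip-punchIn (suc i) (suc k) (b ∷ x@(_ ∷ _)) with flip (punchIn i k) x | removeAt-flip-punchIn i k x
... | _ ∷ _ | eq = cong (b ∷_) eq

insertAt-lookup-removeAt : ∀ {n} (x : Vertex (suc n)) i b → lookup x i ≡ b →
  insertAt (removeAt x i) i b ≡ x
insertAt-lookup-removeAt x i b refl = Vec.insertAt-removeAt x i

-- Walks and connectedness

data Walk {n} (P : Vertex n → Set) : Vertex n → Vertex n → Set where
  here : ∀ {u} → P u → Walk P u u
  step : ∀ {u w z} → P u → Adj u w → Walk P w z → Walk P u z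

module _ {n} {P : Vertex n → Set} where

  walk-trans : ∀ {u v w} → Walk P u v → Walk P v w → Walk P u w
  walk-trans (here _) q = q
  walk-trans (step pu a p) q = step pu a (walk-trans p q)

  walk-end : ∀ {u v} → Walk P u v → P v
  walk-end (here pv) = pv
  walk-end (step _ _ p) = walk-end p

  walk-snoc : ∀ {u v w} → Walk P u v → Adj v w → P w → Walk P u w
  walk-snoc p a pw = walk-trans p (step (walk-end p) a (here pw))

  walk-sym : ∀ {u v} → Walk P u v → Walk P v u
  walk-sym (here pu) = here pu
  walk-sym (step {u} {w} pu a p) = walk-snoc (walk-sym p) (adj-sym u w a) pu

walk-map : ∀ {m n} {P : Vertex m → Set} {Q : Vertex n → Set} (f : Vertex m → Vertex n) →
  (∀ x y → Adj x y → Adj (f x) (f y)) → (∀ {x} → P x → Q (f x)) →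
  ∀ {u v} → Walk P u v → Walk Q (f u) (f v)
walk-map f fadj fP (here pu) = here (fP pu)
walk-map f fadj fP (step pu a p) = step (fP pu) (fadj _ _ a) (walk-map f fadj fP p)

-- For an arbitrary predicate and not for a family as in `Reach`, since the removed set restricted
-- to a half of the cube need not consist of cycles.
Connected : ∀ {n} → (Vertex n → Set) → Set
Connected P = ∀ u v → P u → P v → Walk P u v

-- Both endpoints walk into the half `b`, and the two walks are joined inside it. Only one half has
-- to be connected, which leaves the choice of the better one.
connected-via-half : ∀ {n} {P : Vertex (suc n) → Set} (i : Fin (suc n)) (b : Bool) →
  Connected (λ y → P (insertAt y i b)) →
  (∀ x → P x → ∃ λ z → lookup z i ≡ b × Walk P x z) →
  Connected P
connected-via-half {P = P} i b conn escape u v pu pv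
  with escape u pu | escape v pv
... | u′ , eu , wu | v′ , ev , wv = walk-trans wu (walk-trans mid (walk-sym wv))
  where
  back : ∀ {z} → lookup z i ≡ b → insertAt (removeAt z i) i b ≡ z
  back {z} = insertAt-lookup-removeAt z i b
  mid : Walk P u′ v′
  mid = subst₂ (Walk P) (back eu) (back ev) (walk-map (λ y → insertAt y i b) (insertAt-adj i b) (λ p → p)
    (conn (removeAt u′ i) (removeAt v′ i)
      (subst P (sym (back eu)) (walk-end wu)) (subst P (sym (back ev)) (walk-end wv))))

-- Removing faces of bounded dimension

-- A subcube of Q_n: `just b` fixes a coordinate and `nothing` leaves it free.
Face : ℕ → Set
Face n = Vec (Maybe Bool) n

dim : ∀ {n} → Face n → ℕ
dim [] = 0
dim (nothing ∷ f) = suc (dim f)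
dim (just _ ∷ f) = dim f

data _∋_ : ∀ {n} → Face n → Vertex n → Set where
  []    : [] ∋ []
  free  : ∀ {n} {f : Face n} {b x} → f ∋ x → (nothing ∷ f) ∋ (b ∷ x)
  fixed : ∀ {n} {f : Face n} {b x} → f ∋ x → (just b ∷ f) ∋ (b ∷ x)

Covered : ∀ {n} → List (Face n) → Vertex n → Set
Covered fs x = Any (_∋ x) fs

half : ∀ {n} → Bool → List (Face (suc n)) → List (Face n)
half b [] = []
half b ((nothing ∷ f) ∷ fs) = f ∷ half b fs
half true ((just true ∷ f) ∷ fs) = f ∷ half true fs
half true ((just false ∷ f) ∷ fs) = half true fs
half false ((just true ∷ f) ∷ fs) = half false fs
half false ((just false ∷ f) ∷ fs) = f ∷ half false fs

covered-half⁺ : ∀ {n} b (fs : List (Face (suc n))) {x} → Covered fs (b ∷ x) → Covered (half b fs) x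
covered-half⁺ b ((nothing ∷ f) ∷ fs) (here (free p)) = here p
covered-half⁺ true ((just true ∷ f) ∷ fs) (here (fixed p)) = here p
covered-half⁺ false ((just false ∷ f) ∷ fs) (here (fixed p)) = here p
covered-half⁺ b ((nothing ∷ f) ∷ fs) (there p) = there (covered-half⁺ b fs p)
covered-half⁺ true ((just true ∷ f) ∷ fs) (there p) = there (covered-half⁺ true fs p)
covered-half⁺ true ((just false ∷ f) ∷ fs) (there p) = covered-half⁺ true fs p
covered-half⁺ false ((just true ∷ f) ∷ fs) (there p) = covered-half⁺ false fs p
covered-half⁺ false ((just false ∷ f) ∷ fs) (there p) = there (covered-half⁺ false fs p)

covered-half⁻ : ∀ {n} b (fs : List (Face (suc n))) {x} → Covered (half b fs) x → Covered fs (b ∷ x)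
covered-half⁻ b ((nothing ∷ f) ∷ fs) (here p) = here (free p)
covered-half⁻ b ((nothing ∷ f) ∷ fs) (there p) = there (covered-half⁻ b fs p)
covered-half⁻ true ((just true ∷ f) ∷ fs) (here p) = here (fixed p)
covered-half⁻ true ((just true ∷ f) ∷ fs) (there p) = there (covered-half⁻ true fs p)
covered-half⁻ true ((just false ∷ f) ∷ fs) p = there (covered-half⁻ true fs p)
covered-half⁻ false ((just true ∷ f) ∷ fs) p = there (covered-half⁻ false fs p)
covered-half⁻ false ((just false ∷ f) ∷ fs) (here p) = here (fixed p)
covered-half⁻ false ((just false ∷ f) ∷ fs) (there p) = there (covered-half⁻ false fs p)

length-half : ∀ {n} b (fs : List (Face (suc n))) → length (half b fs) ≤ length fs
length-half b [] = z≤n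
length-half b ((nothing ∷ f) ∷ fs) = s≤s (length-half b fs)
length-half true ((just true ∷ f) ∷ fs) = s≤s (length-half true fs)
length-half true ((just false ∷ f) ∷ fs) = ℕ.m≤n⇒m≤1+n (length-half true fs)
length-half false ((just true ∷ f) ∷ fs) = ℕ.m≤n⇒m≤1+n (length-half false fs)
length-half false ((just false ∷ f) ∷ fs) = s≤s (length-half false fs)

dim-half : ∀ {n d} b {fs : List (Face (suc n))} → All (λ f → dim f ≤ d) fs →
  All (λ f → dim f ≤ d) (half b fs)
dim-half b [] = []
dim-half b {(nothing ∷ f) ∷ fs} (p ∷ ps) = ℕ.<⇒≤ p ∷ dim-half b ps
dim-half true {(just true ∷ f) ∷ fs} (p ∷ ps) = p ∷ dim-half true ps
dim-half true {(just false ∷ f) ∷ fs} (p ∷ ps) = dim-half true ps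
dim-half false {(just true ∷ f) ∷ fs} (p ∷ ps) = dim-half false ps
dim-half false {(just false ∷ f) ∷ fs} (p ∷ ps) = p ∷ dim-half false ps

-- `half` drops exactly the faces that miss the half, so that missing none can be expressed by
-- lengths.
AllMeet : ∀ {n} → Bool → List (Face (suc n)) → Set
AllMeet b fs = length fs ≤ length (half b fs)

-- If all faces meet one side, those meeting the other side cross, and so lose a dimension there.
dim-half-opposite : ∀ {n d} b (fs : List (Face (suc n))) → AllMeet b fs →
  All (λ f → dim f ≤ d) fs → All (λ f → suc (dim f) ≤ d) (half (not b) fs)
dim-half-opposite b [] _ _ = []
dim-half-opposite b ((nothing ∷ f) ∷ fs) (s≤s m) (p ∷ ps) = p ∷ dim-half-opposite b fs m ps
dim-half-opposite true ((just true ∷ f) ∷ fs) (s≤s m) (p ∷ ps) = dim-half-opposite true fs m ps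
dim-half-opposite true ((just false ∷ f) ∷ fs) m _ = contradiction m (ℕ.<⇒≱ (s≤s (length-half true fs)))
dim-half-opposite false ((just true ∷ f) ∷ fs) m _ = contradiction m (ℕ.<⇒≱ (s≤s (length-half false fs)))
dim-half-opposite false ((just false ∷ f) ∷ fs) (s≤s m) (p ∷ ps) = dim-half-opposite false fs m ps

-- A face meeting the opposite half crosses, and a crossing face has the same trace on both halves.
half-opposite-⊆ : ∀ {n} b (fs : List (Face (suc n))) → AllMeet b fs →
  ∀ {x} → Covered (half (not b) fs) x → Covered (half b fs) x
half-opposite-⊆ b ((nothing ∷ f) ∷ fs) m (here p) = here p
half-opposite-⊆ b ((nothing ∷ f) ∷ fs) (s≤s m) (there p) = there (half-opposite-⊆ b fs m p)
half-opposite-⊆ true ((just true ∷ f) ∷ fs) (s≤s m) p = there (half-opposite-⊆ true fs m p)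
half-opposite-⊆ true ((just false ∷ f) ∷ fs) m _ = contradiction m (ℕ.<⇒≱ (s≤s (length-half true fs)))
half-opposite-⊆ false ((just true ∷ f) ∷ fs) m _ = contradiction m (ℕ.<⇒≱ (s≤s (length-half false fs)))
half-opposite-⊆ false ((just false ∷ f) ∷ fs) (s≤s m) p = there (half-opposite-⊆ false fs m p)

-- For `d = 0` no face can cross, so the opposite half meets no face at all. Otherwise the loss of a
-- dimension pays for the loss of a coordinate, even if the number of faces stays the same.
opposite-bound : ∀ {n d N} b (fs : List (Face (suc n))) → AllMeet b fs →
  All (λ f → dim f ≤ d) fs → length fs + d ≤ N →
  All (λ f → dim f ≤ pred d) (half (not b) fs) × length (half (not b) fs) + pred d ≤ pred N
opposite-bound {d = zero} b fs m ps le with half (not b) fs | dim-half-opposite b fs m ps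
... | [] | _ = [] , z≤n
... | _ ∷ _ | () ∷ _
opposite-bound {d = suc d} {N} b fs m ps le =
  All.map s≤s⁻¹ (dim-half-opposite b fs m ps) ,
  ℕ.≤-trans (ℕ.+-monoˡ-≤ d (length-half (not b) fs))
    (ℕ.pred-mono-≤ {suc (length fs + d)} {N} (subst (_≤ N) (ℕ.+-suc (length fs) d) le))

smaller-bound : ∀ {k l d N} → k < l → l + d ≤ N → k + d ≤ pred N
smaller-bound {d = d} k<l le = ℕ.pred-mono-≤ (ℕ.≤-trans (ℕ.+-monoˡ-≤ d k<l) le)

-- Not sharp: length fs < 2 ^ (n ∸ d) would suffice.
∃-uncovered : ∀ n {d} (fs : List (Face n)) → All (λ f → dim f ≤ d) fs → length fs + d ≤ n →
  ∃ λ x → ¬ Covered fs x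
∃-uncovered zero [] _ _ = [] , λ ()
∃-uncovered (suc n) {d} fs ps le with length (half true fs) ℕ.<? length fs
... | yes lt with ∃-uncovered n (half true fs) (dim-half true ps) (smaller-bound {d = d} lt le)
...   | x , ¬c = true ∷ x , ¬c ∘ covered-half⁺ true fs
∃-uncovered (suc n) fs ps le | no ≮ with opposite-bound true fs (ℕ.≮⇒≥ ≮) ps le
... | ps′ , le′ with ∃-uncovered n (half false fs) ps′ le′
...   | x , ¬c = false ∷ x , ¬c ∘ covered-half⁺ false fs

tailFace : ∀ {n} → Face (suc n) → Face n
tailFace (_ ∷ f) = f

dim-tailFace : ∀ {n} (f : Face (suc n)) → dim (tailFace f) ≤ dim f
dim-tailFace (nothing ∷ f) = ℕ.n≤1+n _
dim-tailFace (just _ ∷ f) = ℕ.≤-refl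

∋-tailFace : ∀ {n} {f : Face (suc n)} {b x} → f ∋ (b ∷ x) → tailFace f ∋ x
∋-tailFace (free p) = p
∋-tailFace (fixed p) = p

-- Project all faces along the first direction; the whole fibre over an uncovered point is
-- uncovered.
∃-uncovered-edge : ∀ {n d} (fs : List (Face (suc n))) → All (λ f → dim f ≤ d) fs →
  length fs + d ≤ n → ∃ λ x → ∀ b → ¬ Covered fs (b ∷ x)
∃-uncovered-edge {n} fs ps le
  with ∃-uncovered n (map tailFace fs)
         (All.map⁺ (All.map (λ {f} → ℕ.≤-trans (dim-tailFace f)) ps))
         (subst (λ l → l + _ ≤ n) (sym (List.length-map tailFace fs)) le)
... | x , ¬c = x , λ b c → ¬c (Any.map⁺ (Any.map ∋-tailFace c))

connected-resp : ∀ {n} {P Q : Vertex n → Set} → (∀ {x} → P x → Q x) → (∀ {x} → Q x → P x) →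
  Connected P → Connected Q
connected-resp to from conn u v qu qv = walk-map (λ x → x) (λ _ _ a → a) to (conn u v (from qu) (from qv))

adj-head : ∀ b {n} (x : Vertex n) → Adj (b ∷ x) (not b ∷ x)
adj-head b x = adj-flip zero (b ∷ x)

faces-connected : ∀ n {d} (fs : List (Face n)) → All (λ f → dim f ≤ d) fs →
  length fs + d ≤ pred n → Connected (¬_ ∘ Covered fs)
faces-connected zero fs _ _ [] [] p _ = here p
faces-connected (suc n) {d} fs ps le =
  cases (length (half true fs) ℕ.<? length fs) (length (half false fs) ℕ.<? length fs)
  where
  Free : Vertex (suc n) → Set
  Free = ¬_ ∘ Covered fs
  fromHalf : ∀ b → Connected (¬_ ∘ Covered (half b fs)) → Connected (λ y → Free (b ∷ y))
  fromHalf b = connected-resp (λ ¬c → ¬c ∘ covered-half⁺ b fs) (λ ¬c → ¬c ∘ covered-half⁻ b fs)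

  allMeet : ∀ b → AllMeet b fs → Connected Free
  allMeet b m = connected-via-half zero (not b)
    (fromHalf (not b) (let ps′ , le′ = opposite-bound b fs m ps le in faces-connected n _ ps′ le′))
    escape
    where
    escape : ∀ x → Free x → ∃ λ z → lookup z zero ≡ not b × Walk Free x z
    escape (c ∷ x) ¬c with c Bool.≟ b
    ... | no c≢b = c ∷ x , Bool.¬-not c≢b , here ¬c
    -- The vertex across is free as well: by `half-opposite-⊆`, whatever covers it would also cover
    -- the vertex on side `b`.
    ... | yes refl = not b ∷ x , refl , step ¬c (adj-head b x)
      (here (¬c ∘ covered-half⁻ b fs ∘ half-opposite-⊆ b fs m ∘ covered-half⁺ (not b) fs))

  smallHalf : ∀ b → length (half b fs) < length fs → Connected (λ y → Free (b ∷ y))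
  smallHalf b lt = fromHalf b (faces-connected n _ (dim-half b ps) (smaller-bound lt le))

  cases : Dec (length (half true fs) < length fs) → Dec (length (half false fs) < length fs) → Connected Free
  cases (no ≮) _ = allMeet true (ℕ.≮⇒≥ ≮)
  cases _ (no ≮) = allMeet false (ℕ.≮⇒≥ ≮)
  cases (yes lt₁) (yes lt₀) = connected-via-half zero true (smallHalf true lt₁) escape
    where
    escape : ∀ x → Free x → ∃ λ z → lookup z zero ≡ true × Walk Free x z
    escape (true ∷ x) ¬c = true ∷ x , refl , here ¬c
    -- Both halves are connected by induction, and an uncovered edge joins them.
    escape (false ∷ x) ¬c with ∃-uncovered-edge fs ps le
    ... | y , ¬cy = true ∷ y , refl , walk-snoc
      (walk-map (false ∷_) (adj-∷ false) (λ p → p) (smallHalf false lt₀ x y ¬c (¬cy false)))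
      (adj-head false y) (¬cy true)

point : ∀ {n} → Vertex n → Face n
point [] = []
point (b ∷ x) = just b ∷ point x

dim-point : ∀ {n} (x : Vertex n) → dim (point x) ≤ 0
dim-point [] = z≤n
dim-point (b ∷ x) = dim-point x

point-∋ : ∀ {n} (x : Vertex n) → point x ∋ x
point-∋ [] = []
point-∋ (b ∷ x) = fixed (point-∋ x)

point-∋⇒≡ : ∀ {n} (x : Vertex n) {y} → point x ∋ y → y ≡ x
point-∋⇒≡ [] [] = refl
point-∋⇒≡ (b ∷ x) (fixed p) = cong (b ∷_) (point-∋⇒≡ x p)

-- The classical connectivity of the hypercube, obtained by regarding vertices as faces of dimension
-- 0.
vertices-connected : ∀ {n} (S : List (Vertex n)) → length S ≤ pred n → Connected (_∉ S)
vertices-connected {n} S le = connected-resp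
  (λ ¬c x∈S → ¬c (Any.map⁺ (Any.map (λ { refl → point-∋ _ }) x∈S)))
  (λ x∉S c → x∉S (Any.map (λ {y} → point-∋⇒≡ y) (Any.map⁻ c)))
  (faces-connected n {0} (map point S) (All.map⁺ (All.universal dim-point S))
    (subst (_≤ pred n) (sym (trans (ℕ.+-identityʳ _) (List.length-map point S))) le))

-- Removing few vertices

_∈?_ : ∀ {n} (x : Vertex n) S → Dec (x ∈ S)
_∈?_ = DecMembership._∈?_ _≟_

side : ∀ {n} → Fin (suc n) → Bool → List (Vertex (suc n)) → List (Vertex n)
side i b [] = []
side i b (s ∷ S) with lookup s i Bool.≟ b
... | yes _ = removeAt s i ∷ side i b S
... | no _ = side i b S

∈-side⁺ : ∀ {n} {i : Fin (suc n)} {b s S} → s ∈ S → lookup s i ≡ b → removeAt s i ∈ side i b S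
∈-side⁺ {i = i} {b} {S = s ∷ S} s∈S eq with lookup s i Bool.≟ b | s∈S
... | yes _ | here refl = here refl
... | yes _ | there p = there (∈-side⁺ p eq)
... | no ≢b | here refl = contradiction eq ≢b
... | no _ | there p = ∈-side⁺ p eq

∈-side⁻ : ∀ {n} {i : Fin (suc n)} {b y S} → y ∈ side i b S → insertAt y i b ∈ S
∈-side⁻ {i = i} {b} {S = s ∷ S} y∈ with lookup s i Bool.≟ b | y∈
... | yes eq | here refl = here (insertAt-lookup-removeAt s i b eq)
... | yes _ | there p = there (∈-side⁻ p)
... | no _ | p = there (∈-side⁻ p)

length-side : ∀ {n} (i : Fin (suc n)) S →
  length (side i false S) + length (side i true S) ≡ length S
length-side i [] = refl
length-side i (s ∷ S) with lookup s i Bool.≟ false | lookup s i Bool.≟ true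
... | yes _ | no _ = cong suc (length-side i S)
... | no _ | yes _ = trans (ℕ.+-suc (length (side i false S)) _) (cong suc (length-side i S))
... | yes p | yes q = contradiction (trans (sym p) q) λ ()
... | no p | no q = contradiction (Bool.¬-not p) q

small-side : ∀ {n N} (i : Fin (suc n)) S → length S ≤ N + N → ∃ λ b → length (side i b S) ≤ N
small-side {N = N} i S le with length (side i false S) ℕ.≤? N
... | yes p = false , p
... | no ≰ = true , ℕ.+-cancelˡ-≤ N _ _ (ℕ.≤-trans (ℕ.+-monoˡ-≤ _ (ℕ.<⇒≤ (ℕ.≰⇒> ≰)))
  (subst (_≤ N + N) (sym (length-side i S)) le))

small-side′ : ∀ {n N} (i : Fin (suc n)) S → length S < N + N → ∃ λ b → length (side i b S) < N
small-side′ {N = N} i S lt with length (side i false S) ℕ.<? N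
... | yes p = false , p
... | no ≮ = true , ℕ.+-cancelˡ-< N _ _ (ℕ.≤-<-trans (ℕ.+-monoˡ-≤ _ (ℕ.≮⇒≥ ≮))
  (subst (_< N + N) (sym (length-side i S)) lt))

side-connected : ∀ {n} {i : Fin (suc n)} {b S} → Connected (_∉ side i b S) →
  Connected (λ y → insertAt y i b ∉ S)
side-connected {i = i} {b} {S} = connected-resp
  (λ {y} ∉side ∈S → ∉side (subst (_∈ side i b S) (Vec.removeAt-insertAt y i b)
    (∈-side⁺ ∈S (Vec.insertAt-lookup y i b))))
  (λ ∉S ∈side → ∉S (∈-side⁻ ∈side))

-- The condition of restricted connectivity: the removal isolates no vertex.
NoTrap : ∀ {n} → List (Vertex n) → Set
NoTrap S = ∀ x → x ∉ S → ∃ λ k → flip k x ∉ S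

neighbours : ∀ {n} → Vertex n → List (Vertex n)
neighbours x = tabulate (λ k → flip k x)

neighbours-unique : ∀ {n} (x : Vertex n) → Unique (neighbours x)
neighbours-unique x = Unique.tabulate⁺ (flip-injective x)

neighbours-parity : ∀ {n} (x : Vertex n) {y} → y ∈ neighbours x → parity y ≡ not (parity x)
neighbours-parity x y∈ with ∈.∈-tabulate⁻ y∈
... | k , refl = parity-flip k x

parity-≡⇒¬neighbour : ∀ {n} {x y : Vertex n} → parity y ≡ parity x → y ∉ neighbours x
parity-≡⇒¬neighbour {x = x} eq y∈ = Bool.not-¬ eq (neighbours-parity x y∈)

-- The two neighbourhoods lie in opposite parity classes and are therefore disjoint.
adjacent-neighbourhoods-length : ∀ {n} {x y : Vertex n} {L} → parity y ≡ not (parity x) →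
  (∀ k → flip k x ∈ L) → (∀ k → flip k y ∈ L) → n + n ≤ length L
adjacent-neighbourhoods-length {n} {x} {y} {L} py x⊆ y⊆ = subst (_≤ length L)
  (trans (List.length-++ (neighbours x))
    (cong₂ _+_ (List.length-tabulate (λ k → flip k x)) (List.length-tabulate (λ k → flip k y))))
  (unique⊆⇒length≤ (Unique.++⁺ (neighbours-unique x) (neighbours-unique y) disjoint) sub)
  where
  disjoint : ∀ {z} → z ∈ neighbours x × z ∈ neighbours y → ⊥
  disjoint (z∈x , z∈y) = parity-≡⇒¬neighbour {x = y} (trans (neighbours-parity x z∈x) (sym py)) z∈y
  sub : ∀ {z} → z ∈ neighbours x ++ neighbours y → z ∈ L
  sub z∈ with ∈.∈-++⁻ (neighbours x) z∈
  ... | inj₁ p with ∈.∈-tabulate⁻ p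
  ...   | k , refl = x⊆ k
  sub z∈ | inj₂ p with ∈.∈-tabulate⁻ p
  ...   | k , refl = y⊆ k

-- If x is stuck in its half (in direction i) even within two steps, through y say, then S contains
-- a point above or below every neighbour of x and of y in the half: these are 2N points.
escape : ∀ {N} (i : Fin (suc N)) S L → length L < N + N → (∀ {s} → s ∈ S → removeAt s i ∈ L) →
  NoTrap S → ∀ b x → x ∉ S → ∃ λ z → lookup z i ≡ b × Walk (_∉ S) x z
escape {N} i S L L< proj noTrap b x x∉S = start (good? x)
  where
  Good : Vertex (suc N) → Set
  Good z = z ∉ S × flip i z ∉ S
  good? : ∀ z → Dec (Good z)
  good? z = ¬? (z ∈? S) ×-dec ¬? (flip i z ∈? S)

  Target : Set
  Target = ∃ λ z → lookup z i ≡ b × Walk (_∉ S) x z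

  finish : ∀ {z} → Walk (_∉ S) x z → Good z → Target
  finish {z} p (_ , fz∉S) with lookup z i Bool.≟ b
  ... | yes eq = z , eq , p
  ... | no ≢b = flip i z ,
    trans (Vec.lookup∘updateAt i z) (trans (cong not (Bool.¬-not ≢b)) (Bool.not-involutive b)) ,
    walk-snoc p (adj-flip i z) fz∉S

  bad⇒∈L : ∀ {z} → ¬ Good z → removeAt z i ∈ L
  bad⇒∈L {z} bad with z ∈? S | flip i z ∈? S
  ... | yes z∈ | _ = proj z∈
  ... | no _ | yes fz∈ = subst (_∈ L) (removeAt-flip i z) (proj fz∈)
  ... | no z∉ | no fz∉ = contradiction (z∉ , fz∉) bad

  shadow : ∀ {u} → (∀ k → ¬ Good (flip k u)) → ∀ k → flip k (removeAt u i) ∈ L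
  shadow {u} bad k = subst (_∈ L) (removeAt-flip-punchIn i k u) (bad⇒∈L (bad (punchIn i k)))

  start : Dec (Good x) → Target
  start (yes good) = finish (here x∉S) good
  start (no bad) with Fin.any? (λ k → good? (flip k x)) | noTrap x x∉S
  ... | yes (k , good) | _ = finish (step x∉S (adj-flip k x) (here (proj₁ good))) good
  ... | no bad₁ | j , y∉S with Fin.any? (λ k → good? (flip k (flip j x)))
  ...   | yes (k , good) = finish (step x∉S (adj-flip j x) (step y∉S (adj-flip k (flip j x)) (here (proj₁ good)))) good
  ...   | no bad₂ = contradiction
    (adjacent-neighbourhoods-length parity-y (shadow λ k g → bad₁ (k , g)) (shadow λ k g → bad₂ (k , g)))
    (ℕ.<⇒≱ L<)
    where
    i≢j : i ≢ j
    -- If `j` were `i`, then `flip i x` would remain and `x` itself would be good.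
    i≢j refl = bad (x∉S , y∉S)
    parity-y : parity (removeAt (flip j x) i) ≡ not (parity (removeAt x i))
    parity-y = trans
      (cong parity (trans (cong (λ l → removeAt (flip l x) i) (sym (Fin.punchIn-punchOut i≢j)))
        (removeAt-flip-punchIn i (punchOut i≢j) x)))
      (parity-flip (punchOut i≢j) (removeAt x i))

-- One half contains fewer than `N` removed vertices and is connected by `vertices-connected`. Every
-- other vertex gets there by `escape`, with the full projection of `S` as `L`.
noTrap⇒connected : ∀ {N} (S : List (Vertex (suc N))) → length S < N + N → NoTrap S → Connected (_∉ S)
noTrap⇒connected {N} S lt noTrap with small-side′ {N = N} zero S lt
... | b , sm = connected-via-half zero b
  (side-connected (vertices-connected (side zero b S) (ℕ.<⇒≤pred sm)))
  (escape zero S (map (λ s → removeAt s zero) S) (subst (_< N + N) (sym (List.length-map _ S)) lt)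
    (∈.∈-map⁺ _) noTrap b)

-- Says that every element of `S` has at least two neighbours in `S`, in a form that hands out one
-- different from a prescribed `t`.
Thick : ∀ {n} → List (Vertex n) → Set
Thick S = ∀ {s} → s ∈ S → ∀ t → ∃ λ w → w ∈ S × Adj s w × w ≢ t

HasEdge : ∀ {n} → List (Vertex n) → Set
HasEdge S = ∃ λ p → ∃ λ q → p ∈ S × q ∈ S × Adj p q

-- A trapped `x` has all its `n` neighbours in `S`. One end of the edge has the parity of `x`, so it
-- is no neighbour of `x` and makes one element too many.
small∧edge⇒noTrap : ∀ {n} {S : List (Vertex n)} → length S ≤ n → HasEdge S → NoTrap S
small∧edge⇒noTrap {n} {S} le (p , q , p∈S , q∈S , pq) x x∉S =
  Fin.¬∀⟶∃¬ n (λ k → flip k x ∈ S) (λ k → flip k x ∈? S) trapped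
  where
  sameParity : ∃ λ r → r ∈ S × parity r ≡ parity x
  sameParity with parity p Bool.≟ parity x
  ... | yes eq = p , p∈S , eq
  ... | no ≢ = q , q∈S , trans (parity-adj p q pq)
    (trans (cong not (Bool.¬-not ≢)) (Bool.not-involutive (parity x)))
  trapped : ¬ (∀ k → flip k x ∈ S)
  trapped all with sameParity
  ... | r , r∈S , pr = ℕ.<-irrefl (List.length-tabulate (λ k → flip k x))
    (ℕ.≤-trans (unique⊆⇒length≤ (All.tabulate r∉ ∷ neighbours-unique x) sub) le)
    where
    r∉ : ∀ {z} → z ∈ neighbours x → r ≢ z
    r∉ z∈ refl = parity-≡⇒¬neighbour {x = x} pr z∈
    sub : ∀ {z} → z ∈ r ∷ neighbours x → z ∈ S
    sub (here refl) = r∈S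
    sub (there z∈) with ∈.∈-tabulate⁻ z∈
    ... | k , refl = all k

side-edge : ∀ {n} (i : Fin (suc n)) {S s w b} → s ∈ S → w ∈ S → Adj s w → w ≢ flip i s →
  lookup s i ≡ b → HasEdge (side i b S)
side-edge i {S} {s} {w} {b} s∈S w∈S sw w≢ eq with adj⇒flip s w sw
... | j , refl = removeAt s i , removeAt (flip j s) i , ∈-side⁺ s∈S eq ,
  ∈-side⁺ w∈S (trans (Vec.lookup∘updateAt′ i j i≢j s) eq) ,
  subst (Adj (removeAt s i))
    (trans (sym (removeAt-flip-punchIn i (punchOut i≢j) s))
      (cong (λ l → removeAt (flip l s) i) (Fin.punchIn-punchOut i≢j)))
    (adj-flip (punchOut i≢j) (removeAt s i))
  where
  i≢j : i ≢ j
  i≢j refl = w≢ refl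

-- Splitting along the direction of an edge of S has two effects: the projection of S to a half
-- loses a point, and each half of S still contains an edge.
thick⇒connected : ∀ {N} (S : List (Vertex (suc N))) → 3 ≤ N → length S ≤ N + N →
  NoTrap S → Thick S → Connected (_∉ S)
thick⇒connected [] _ _ _ _ = vertices-connected [] z≤n
thick⇒connected {suc N} S@(s ∷ _) (s≤s 2≤N) le noTrap thick
  with thick (here refl) s
... | w , w∈S , sw , w≢s with adj⇒flip s w sw
... | i , refl with thick (here refl) w | thick w∈S s | delete {ys = S} (here refl)
                  | small-side i S le
... | w₂ , w₂∈S , sw₂ , w₂≢w | w₃ , w₃∈S , ww₃ , w₃≢s | zs , eq , keep | b , sm =
  connected-via-half i b
    -- The half has at most `suc N` removed vertices, among them an edge. Hence it has no trapped
    -- vertex, and `suc N < N + N` suffices for its connectedness.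
    (side-connected (noTrap⇒connected (side i b S) (ℕ.≤-<-trans sm 1+N<2N) (small∧edge⇒noTrap sm edge)))
    (escape i S (map (λ z → removeAt z i) zs)
      (subst (_< suc N + suc N) (sym (List.length-map _ zs)) (subst (_≤ suc N + suc N) eq le))
      proj noTrap b)
  where
  1+N<2N : suc N < N + N
  1+N<2N = ℕ.+-monoˡ-≤ N 2≤N
  edge′ : Dec (lookup s i ≡ b) → HasEdge (side i b S)
  -- Whichever end of the edge from `s` to `w` lies in the half `b`, its second neighbour in `S`
  -- lies there too.
  edge′ (yes e) = side-edge i (here refl) w₂∈S sw₂ w₂≢w e
  edge′ (no ≢b) = side-edge i w∈S w₃∈S ww₃ (λ e → w₃≢s (trans e (flip-involutive i s)))
    (trans (Vec.lookup∘updateAt i s) (trans (cong not (Bool.¬-not ≢b)) (Bool.not-involutive b)))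
  edge : HasEdge (side i b S)
  edge = edge′ (lookup s i Bool.≟ b)
  proj : ∀ {x} → x ∈ S → removeAt x i ∈ map (λ z → removeAt z i) zs
  proj {x} x∈S with x ≟ s
  -- `s` may be left out of `zs` because `w`, which is `flip i s`, has the same projection.
  ... | yes refl = subst (_∈ _) (removeAt-flip i s) (∈.∈-map⁺ _ (keep w∈S w≢s))
  ... | no x≢s = ∈.∈-map⁺ _ (keep x∈S x≢s)

-- Lower bounds for cycle families

vertices : ∀ {n k} → List (Cycle n k) → List (Vertex n)
vertices [] = []
vertices {k = k} (C ∷ F) = applyUpTo (Cycle.v C) k ++ vertices F

length-vertices : ∀ {n k} (F : List (Cycle n k)) → length (vertices F) ≡ length F * k
length-vertices [] = refl
length-vertices {k = k} (C ∷ F) = trans (List.length-++ (applyUpTo (Cycle.v C) k))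
  (cong₂ _+_ (List.length-applyUpTo (Cycle.v C) k) (length-vertices F))

∈-cycle⁺ : ∀ {n k w} {C : Cycle n k} → InCycle w C → w ∈ applyUpTo (Cycle.v C) k
∈-cycle⁺ {C = C} (i , i<k , refl) = ∈.∈-applyUpTo⁺ (Cycle.v C) i<k

∈-cycle⁻ : ∀ {n k w} {C : Cycle n k} → w ∈ applyUpTo (Cycle.v C) k → InCycle w C
∈-cycle⁻ {C = C} w∈ with ∈.∈-applyUpTo⁻ (Cycle.v C) w∈
... | i , i<k , refl = i , i<k , refl

∈-vertices⁺ : ∀ {n k w} {F : List (Cycle n k)} → InFamily w F → w ∈ vertices F
∈-vertices⁺ {F = C ∷ F} (here p) = ∈.∈-++⁺ˡ (∈-cycle⁺ {C = C} p)
∈-vertices⁺ {k = k} {F = C ∷ F} (there p) = ∈.∈-++⁺ʳ (applyUpTo (Cycle.v C) k) (∈-vertices⁺ p)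

∈-vertices⁻ : ∀ {n k w} {F : List (Cycle n k)} → w ∈ vertices F → InFamily w F
∈-vertices⁻ {k = k} {F = C ∷ F} w∈ with ∈.∈-++⁻ (applyUpTo (Cycle.v C) k) w∈
... | inj₁ p = here (∈-cycle⁻ {C = C} p)
... | inj₂ p = there (∈-vertices⁻ p)

walk⇒reach : ∀ {n k} {F : List (Cycle n k)} {u w} → Walk (Remains F) u w → Reach F u w
walk⇒reach (here r) = here r
walk⇒reach (step r a p) = step r a (walk⇒reach p)

connected⇒¬cut : ∀ {n k} {F : List (Cycle n k)} → Connected (Remains F) →
  (∀ u → Remains F u → ∃ λ w → Remains F w × w ≢ u) → ¬ IsStructureCut F
connected⇒¬cut conn _ (inj₁ (u , w , ru , rw , ¬reach)) = ¬reach (walk⇒reach (conn u w ru rw))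
connected⇒¬cut _ other (inj₂ (u , ru , only)) with other u ru
... | w , rw , w≢u = w≢u (only w rw)

flip-≢ : ∀ {n} (i : Fin n) (x : Vertex n) → flip i x ≢ x
flip-≢ i x eq = Bool.not-¬ refl (trans (cong parity (sym eq)) (parity-flip i x))

halve : ∀ i → ∃ λ j → i ≡ j + j ⊎ i ≡ suc (j + j)
halve zero = zero , inj₁ refl
halve (suc i) with halve i
... | j , inj₁ refl = j , inj₂ refl
... | j , inj₂ refl = suc j , inj₁ (cong suc (sym (ℕ.+-suc j j)))

double-cancel-< : ∀ {j h} → j + j < 2 * h → j < h
double-cancel-< {j} {h} lt = ℕ.*-cancelˡ-< 2 j h
  (subst (_< 2 * h) (cong (j +_) (sym (ℕ.+-identityʳ j))) lt)

module _ {n k} (C : Cycle n k) where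
  open Cycle C

  parity-v-even : ∀ j → j + j < k → parity (v (j + j)) ≡ parity (v 0)
  parity-v-odd : ∀ j → suc (j + j) < k → parity (v (suc (j + j))) ≡ not (parity (v 0))
  parity-v-even zero _ = refl
  parity-v-even (suc j) lt rewrite ℕ.+-suc j j = trans
    (parity-adj (v (suc (j + j))) _ (adjStep _ lt))
    (trans (cong not (parity-v-odd j (ℕ.<⇒≤ lt))) (Bool.not-involutive _))
  parity-v-odd j lt = trans (parity-adj (v (j + j)) _ (adjStep _ lt))
    (cong not (parity-v-even j (ℕ.<⇒≤ lt)))

  two-neighbours : 3 ≤ k → ∀ i → i < k → ∃ λ a → ∃ λ b →
    (a < k × Adj (v i) (v a)) × (b < k × Adj (v i) (v b)) × v a ≢ v b
  two-neighbours (s≤s (s≤s (s≤s _))) zero _ = 1 , k ∸ 1 ,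
    (s≤s (s≤s z≤n) , adjStep 0 (s≤s (s≤s z≤n))) ,
    (ℕ.≤-refl , adj-sym (v (k ∸ 1)) (v 0) adjClose) ,
    λ eq → contradiction (distinct 1 (k ∸ 1) (s≤s (s≤s z≤n)) ℕ.≤-refl eq) λ ()
  two-neighbours 3≤k (suc i) lt with suc (suc i) ℕ.<? k
  ... | yes lt′ = i , suc (suc i) ,
    (ℕ.<⇒≤ lt , adj-sym (v i) _ (adjStep i lt)) , (lt′ , adjStep (suc i) lt′) ,
    λ eq → contradiction (distinct i _ (ℕ.<⇒≤ lt) lt′ eq) λ ()
  ... | no ≮ with ℕ.≤-antisym lt (ℕ.≮⇒≥ ≮)
  ...   | refl = i , 0 ,
    (ℕ.<⇒≤ lt , adj-sym (v i) _ (adjStep i lt)) , (s≤s z≤n , adjClose) ,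
    -- Here `suc i` is the last index. If its predecessor `i` were also its successor 0, the cycle
    -- would have length 2.
    λ eq → contradiction (subst (λ j → 3 ≤ suc (suc j)) (distinct i 0 (ℕ.<⇒≤ lt) (s≤s z≤n) eq) 3≤k)
      λ { (s≤s (s≤s ())) }

vertices-thick : ∀ {n k} (F : List (Cycle n k)) → 3 ≤ k → Thick (vertices F)
vertices-thick {k = k} (C ∷ F) 3≤k s∈ t with ∈.∈-++⁻ (applyUpTo (Cycle.v C) k) s∈
... | inj₂ s∈F with vertices-thick F 3≤k s∈F t
...   | w , w∈ , sw , w≢t = w , ∈.∈-++⁺ʳ (applyUpTo (Cycle.v C) k) w∈ , sw , w≢t
vertices-thick {k = k} (C ∷ F) 3≤k s∈ t | inj₁ s∈C with ∈-cycle⁻ {C = C} s∈C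
... | i , i<k , refl with two-neighbours C 3≤k i i<k
...   | a , b , (a<k , va) , (b<k , vb) , va≢vb with Cycle.v C a ≟ t
...     | no va≢t = Cycle.v C a , ∈.∈-++⁺ˡ (∈.∈-applyUpTo⁺ (Cycle.v C) a<k) , va , va≢t
...     | yes refl = Cycle.v C b , ∈.∈-++⁺ˡ (∈.∈-applyUpTo⁺ (Cycle.v C) b<k) , vb , va≢vb ∘ sym

-- For a cycle of length `2 * h`, its `h` vertices of parity `p`: parity alternates along a cycle,
-- so they occupy the even or the odd positions.
class : ∀ {n k} → ℕ → Bool → Cycle n k → List (Vertex n)
class h p C with parity (Cycle.v C 0) Bool.≟ p
... | yes _ = applyUpTo (λ j → Cycle.v C (j + j)) h
... | no _ = applyUpTo (λ j → Cycle.v C (suc (j + j))) h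

length-class : ∀ {n k} h p (C : Cycle n k) → length (class h p C) ≡ h
length-class h p C with parity (Cycle.v C 0) Bool.≟ p
... | yes _ = List.length-applyUpTo _ h
... | no _ = List.length-applyUpTo _ h

∈-class : ∀ {n} h p (C : Cycle n (2 * h)) {w} → w ∈ applyUpTo (Cycle.v C) (2 * h) →
  parity w ≡ p → w ∈ class h p C
∈-class h p C w∈ pw with ∈-cycle⁻ {C = C} w∈
... | i , i<k , refl with parity (Cycle.v C 0) Bool.≟ p | halve i
...   | yes _ | j , inj₁ refl = ∈.∈-applyUpTo⁺ (λ l → Cycle.v C (l + l)) {j} (double-cancel-< i<k)
...   | no _ | j , inj₂ refl = ∈.∈-applyUpTo⁺ (λ l → Cycle.v C (suc (l + l))) {j} (double-cancel-< (ℕ.<⇒≤ i<k))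
...   | yes p₀ | j , inj₂ refl =
  contradiction (trans (sym (parity-v-odd C j i<k)) (trans pw (sym p₀))) (λ eq → Bool.not-¬ refl (sym eq))
...   | no p₀ | j , inj₁ refl = contradiction (trans (sym (parity-v-even C j i<k)) pw) p₀

classes : ∀ {n k} → ℕ → Bool → List (Cycle n k) → List (Vertex n)
classes h p [] = []
classes h p (C ∷ F) = class h p C ++ classes h p F

length-classes : ∀ {n k} h p (F : List (Cycle n k)) → length (classes h p F) ≡ length F * h
length-classes h p [] = refl
length-classes h p (C ∷ F) = trans (List.length-++ (class h p C))
  (cong₂ _+_ (length-class h p C) (length-classes h p F))

∈-classes : ∀ {n} h p (F : List (Cycle n (2 * h))) {w} → w ∈ vertices F → parity w ≡ p →
  w ∈ classes h p F
∈-classes h p (C ∷ F) w∈ pw with ∈.∈-++⁻ (applyUpTo (Cycle.v C) (2 * h)) w∈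
... | inj₁ w∈C = ∈.∈-++⁺ˡ (∈-class h p C w∈C pw)
... | inj₂ w∈F = ∈.∈-++⁺ʳ (class h p C) (∈-classes h p F w∈F pw)

-- All `n` neighbours of `x` have the same parity, and each cycle contributes only `h` vertices of
-- that parity.
vertices-noTrap : ∀ {n} h (F : List (Cycle n (2 * h))) → length F * h < n → NoTrap (vertices F)
vertices-noTrap {n} h F lt x _ =
  Fin.¬∀⟶∃¬ n (λ k → flip k x ∈ vertices F) (λ k → flip k x ∈? vertices F) λ trapped →
    contradiction
      (subst (_≤ length (classes h (not (parity x)) F)) (List.length-tabulate (λ k → flip k x))
        (unique⊆⇒length≤ (neighbours-unique x) (sub trapped)))
      (ℕ.<⇒≱ (subst (_< n) (sym (length-classes h _ F)) lt))
  where
  sub : (∀ k → flip k x ∈ vertices F) → ∀ {z} → z ∈ neighbours x → z ∈ classes h (not (parity x)) F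
  sub trapped z∈ with ∈.∈-tabulate⁻ z∈
  ... | k , refl = ∈-classes h _ F (trapped k) (parity-flip k x)

long-cycle-cut-bound : ∀ {n h} → 4 ≤ n → 2 ≤ h → (F : List (Cycle n (2 * h))) →
  IsStructureCut F → n ≤ length F * h
long-cycle-cut-bound {suc n} {h} (s≤s 3≤n) 2≤h F cut with suc n ℕ.≤? length F * h
... | yes le = le
... | no ≰ = contradiction cut (connected⇒¬cut
  (connected-resp (λ ∉S p → ∉S (∈-vertices⁺ p)) (λ r ∈S → r (∈-vertices⁻ ∈S))
    (thick⇒connected (vertices F) 3≤n
      (subst (_≤ n + n) (sym (trans (length-vertices F) (expand (length F) h))) (ℕ.+-mono-≤ le le))
      noTrap (vertices-thick F (ℕ.<⇒≤ (ℕ.*-monoʳ-≤ 2 2≤h)))))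
  -- A remaining neighbour of `u` shows that the rest is not a single vertex.
  λ u ru → let k , fu∉ = noTrap u (λ ∈S → ru (∈-vertices⁻ ∈S)) in
    flip k u , (λ p → fu∉ (∈-vertices⁺ p)) , flip-≢ k u)
  where
  le : length F * h ≤ n
  le = s≤s⁻¹ (ℕ.≰⇒> ≰)
  expand : ∀ l h → l * (2 * h) ≡ l * h + l * h
  expand = solve-∀
  noTrap : NoTrap (vertices F)
  noTrap = vertices-noTrap h F (ℕ.≰⇒> ≰)

-- Squares as faces of dimension at most 2

merge : Maybe Bool → Bool → Maybe Bool
merge nothing _ = nothing
merge (just true) true = just true
merge (just false) false = just false
merge (just _) _ = nothing

-- The smallest face containing both `f` and `x`.
extend : ∀ {n} → Face n → Vertex n → Face n
extend [] [] = []
extend (m ∷ f) (b ∷ x) = merge m b ∷ extend f x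

extend-∋ : ∀ {n} (f : Face n) x → extend f x ∋ x
extend-∋ [] [] = []
extend-∋ (nothing ∷ f) (b ∷ x) = free (extend-∋ f x)
extend-∋ (just true ∷ f) (true ∷ x) = fixed (extend-∋ f x)
extend-∋ (just true ∷ f) (false ∷ x) = free (extend-∋ f x)
extend-∋ (just false ∷ f) (true ∷ x) = free (extend-∋ f x)
extend-∋ (just false ∷ f) (false ∷ x) = fixed (extend-∋ f x)

extend-⊇ : ∀ {n} {f : Face n} x {y} → f ∋ y → extend f x ∋ y
extend-⊇ [] [] = []
extend-⊇ (b ∷ x) (free p) = free (extend-⊇ x p)
extend-⊇ (true ∷ x) (fixed {b = true} p) = fixed (extend-⊇ x p)
extend-⊇ (true ∷ x) (fixed {b = false} p) = free (extend-⊇ x p)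
extend-⊇ (false ∷ x) (fixed {b = true} p) = free (extend-⊇ x p)
extend-⊇ (false ∷ x) (fixed {b = false} p) = fixed (extend-⊇ x p)

span : ∀ {n} (a b c d : Vertex n) → Face n
span a b c d = extend (extend (extend (point a) b) c) d

∈-span : ∀ {n} (a b c d : Vertex n) {w} → w ∈ a ∷ b ∷ c ∷ d ∷ [] → span a b c d ∋ w
∈-span a b c d (here refl) = extend-⊇ d (extend-⊇ c (extend-⊇ b (point-∋ a)))
∈-span a b c d (there (here refl)) = extend-⊇ d (extend-⊇ c (extend-∋ _ b))
∈-span a b c d (there (there (here refl))) = extend-⊇ d (extend-∋ _ c)
∈-span a b c d (there (there (there (here refl)))) = extend-∋ _ d

bitDim : Maybe Bool → ℕ
bitDim nothing = 1
bitDim (just _) = 0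

dim-∷ : ∀ {n} m (f : Face n) → dim (m ∷ f) ≡ bitDim m + dim f
dim-∷ nothing f = refl
dim-∷ (just _) f = refl

bitDist : Bool → Bool → ℕ
bitDist a b = hamming (a ∷ []) (b ∷ [])

hamming-split : ∀ {n} a b (x y : Vertex n) → hamming (a ∷ x) (b ∷ y) ≡ bitDist a b + hamming x y
hamming-split true true x y = refl
hamming-split true false x y = refl
hamming-split false true x y = refl
hamming-split false false x y = refl

bitDim-span : ∀ a b c d → 2 * bitDim (merge (merge (merge (just a) b) c) d) ≤
  bitDist a b + bitDist b c + bitDist c d + bitDist d a
bitDim-span true true true true = z≤n
bitDim-span true true true false = s≤s (s≤s z≤n)
bitDim-span true true false true = s≤s (s≤s z≤n)
bitDim-span true true false false = s≤s (s≤s z≤n)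
bitDim-span true false true true = s≤s (s≤s z≤n)
bitDim-span true false true false = s≤s (s≤s z≤n)
bitDim-span true false false true = s≤s (s≤s z≤n)
bitDim-span true false false false = s≤s (s≤s z≤n)
bitDim-span false true true true = s≤s (s≤s z≤n)
bitDim-span false true true false = s≤s (s≤s z≤n)
bitDim-span false true false true = s≤s (s≤s z≤n)
bitDim-span false true false false = s≤s (s≤s z≤n)
bitDim-span false false true true = s≤s (s≤s z≤n)
bitDim-span false false true false = s≤s (s≤s z≤n)
bitDim-span false false false true = s≤s (s≤s z≤n)
bitDim-span false false false false = z≤n

-- Going around the closed walk a b c d, every free coordinate has to change at least twice.
dim-span : ∀ {n} (a b c d : Vertex n) →
  2 * dim (span a b c d) ≤ hamming a b + hamming b c + hamming c d + hamming d a
dim-span [] [] [] [] = z≤n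
dim-span (a ∷ as) (b ∷ bs) (c ∷ cs) (d ∷ ds)
  rewrite dim-∷ (merge (merge (merge (just a) b) c) d) (span as bs cs ds)
        | hamming-split a b as bs | hamming-split b c bs cs
        | hamming-split c d cs ds | hamming-split d a ds as
  = subst₂ _≤_ (sym (ℕ.*-distribˡ-+ 2 (bitDim (merge (merge (merge (just a) b) c) d)) _))
      (rearrange (bitDist a b) (bitDist b c) (bitDist c d) (bitDist d a) _ _ _ _)
      (ℕ.+-mono-≤ (bitDim-span a b c d) (dim-span as bs cs ds))
  where
  rearrange : ∀ p q r s p′ q′ r′ s′ →
    p + q + r + s + (p′ + q′ + r′ + s′) ≡ p + p′ + (q + q′) + (r + r′) + (s + s′)
  rearrange = solve-∀

points : ∀ {n} → Face n → List (Vertex n)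
points [] = [] ∷ []
points (nothing ∷ f) = map (false ∷_) (points f) ++ map (true ∷_) (points f)
points (just b ∷ f) = map (b ∷_) (points f)

length-points : ∀ {n} (f : Face n) → length (points f) ≡ 2 ^ dim f
length-points [] = refl
length-points (nothing ∷ f) = trans (List.length-++ (map (false ∷_) (points f)))
  (cong₂ _+_ (trans (List.length-map _ (points f)) (length-points f))
    (trans (trans (List.length-map _ (points f)) (length-points f)) (sym (ℕ.+-identityʳ _))))
length-points (just b ∷ f) = trans (List.length-map _ (points f)) (length-points f)

∈-points : ∀ {n} {f : Face n} {x} → f ∋ x → x ∈ points f
∈-points [] = here refl
∈-points (free {b = false} p) = ∈.∈-++⁺ˡ (∈.∈-map⁺ _ (∈-points p))
∈-points (free {f = f} {b = true} p) = ∈.∈-++⁺ʳ (map (false ∷_) (points f)) (∈.∈-map⁺ _ (∈-points p))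
∈-points (fixed p) = ∈.∈-map⁺ _ (∈-points p)

module _ {n} (C : Cycle n 4) where
  open Cycle C

  cycleFace : Face n
  cycleFace = span (v 0) (v 1) (v 2) (v 3)

  cycleFace-dim : dim cycleFace ≤ 2
  cycleFace-dim = ℕ.*-cancelˡ-≤ 2 (subst (2 * dim cycleFace ≤_) eq (dim-span (v 0) (v 1) (v 2) (v 3)))
    where
    eq : hamming (v 0) (v 1) + hamming (v 1) (v 2) + hamming (v 2) (v 3) + hamming (v 3) (v 0) ≡ 4
    eq rewrite adjStep 0 (s≤s (s≤s z≤n)) | adjStep 1 (s≤s (s≤s (s≤s z≤n))) | adjStep 2 ℕ.≤-refl
       | adjClose = refl

  inCycle⇒∋ : ∀ {w} → InCycle w C → cycleFace ∋ w
  inCycle⇒∋ p = ∈-span (v 0) (v 1) (v 2) (v 3) (∈-cycle⁺ {C = C} p)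

  -- The face has at most four points, and the four distinct vertices of the cycle already use them
  -- up. So removing the cycle is the same as removing the face.
  ∋⇒inCycle : ∀ {w} → cycleFace ∋ w → InCycle w C
  ∋⇒inCycle {w} p with w ∈? applyUpTo v 4
  ... | yes w∈ = ∈-cycle⁻ {C = C} w∈
  ... | no w∉ = contradiction
    (unique⊆⇒length≤ {ys = points cycleFace}
      (All.tabulate (λ { z∈ refl → w∉ z∈ })
        ∷ Unique.applyUpTo⁺₁ v 4 λ i<j j<4 eq → ℕ.<⇒≢ i<j (distinct _ _ (ℕ.<-trans i<j j<4) j<4 eq))
      λ { (here refl) → ∈-points p
        ; (there z∈) → ∈-points (∈-span (v 0) (v 1) (v 2) (v 3) z∈) })
    (ℕ.<⇒≱ (s≤s (subst (_≤ 4) (sym (length-points cycleFace)) (ℕ.^-monoʳ-≤ 2 cycleFace-dim))))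

4-cycle-cut-bound : ∀ {n} → 2 ≤ n → (F : List (Cycle n 4)) → IsStructureCut F → n ≤ length F + 2
4-cycle-cut-bound {suc n} (s≤s 1≤n) F cut with suc n ℕ.≤? length F + 2
... | yes le = le
... | no ≰ = contradiction cut (connected⇒¬cut
  (connected-resp (λ ¬c → ¬c ∘ cover) (λ r → r ∘ uncover)
    (faces-connected (suc n) (map cycleFace F) dims le))
  other)
  where
  le : length (map cycleFace F) + 2 ≤ n
  le = subst (λ l → l + 2 ≤ n) (sym (List.length-map cycleFace F)) (s≤s⁻¹ (ℕ.≰⇒> ≰))
  dims : All (λ f → dim f ≤ 2) (map cycleFace F)
  dims = All.map⁺ (All.universal cycleFace-dim F)
  cover : ∀ {w} → InFamily w F → Covered (map cycleFace F) w
  cover = Any.map⁺ ∘ Any.map (λ {C} → inCycle⇒∋ C)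
  uncover : ∀ {w} → Covered (map cycleFace F) w → InFamily w F
  uncover = Any.map (λ {C} → ∋⇒inCycle C) ∘ Any.map⁻
  other : ∀ u → Remains F u → ∃ λ w → Remains F w × w ≢ u
  other (b ∷ u) _ with ∃-uncovered-edge (map cycleFace F) dims le
  -- Of the two ends of the uncovered edge, the one differing from `b ∷ u` in the first coordinate.
  ... | x , ¬c = not b ∷ x , ¬c (not b) ∘ cover , λ eq → Bool.not-¬ refl (sym (Vec.∷-injectiveˡ eq))

-- Long cycles through all neighbours of a vertex

data Path {n} : Vertex n → Vertex n → List (Vertex n) → Set where
  [_] : ∀ u → Path u u (u ∷ [])
  _∷_ : ∀ {u w z xs} → Adj u w → Path w z xs → Path u z (u ∷ xs)

path-start-∈ : ∀ {n} {u w : Vertex n} {xs} → Path u w xs → u ∈ xs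
path-start-∈ [ _ ] = here refl
path-start-∈ (_ ∷ _) = here refl

path-++ : ∀ {n} {u v w z : Vertex n} {xs ys} → Path u v xs → Adj v w → Path w z ys → Path u z (xs ++ ys)
path-++ [ _ ] a q = a ∷ q
path-++ (a′ ∷ p) a q = a′ ∷ path-++ p a q

path-map : ∀ {m n} (f : Vertex m → Vertex n) → (∀ x y → Adj x y → Adj (f x) (f y)) →
  ∀ {u v xs} → Path u v xs → Path (f u) (f v) (map f xs)
path-map f f-adj [ u ] = [ f u ]
path-map f f-adj (a ∷ p) = f-adj _ _ a ∷ path-map f f-adj p

path-take : ∀ {n} {u w : Vertex n} {xs} j → Path u w xs → ∃ λ z → Path u z (take (suc j) xs)
path-take j [ u ] = u , subst (λ xs → Path u u (u ∷ xs)) (sym (take-[] j)) [ u ]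
  where
  take-[] : ∀ {a} {A : Set a} j → take {A = A} j [] ≡ []
  take-[] zero = refl
  take-[] (suc j) = refl
path-take {u = u} zero (a ∷ p) = u , [ u ]
path-take (suc j) (a ∷ p) with path-take j p
... | z , q = z , a ∷ q

-- Lists can be concatenated and mapped, so cycles are built in this form and turned into a `Cycle`
-- by `toCycle`.
record ListCycle (n k : ℕ) : Set where
  constructor listCycle
  field
    {start end} : Vertex n
    list        : List (Vertex n)
    path        : Path start end list
    close       : Adj end start
    unique      : Unique list
    size        : length list ≡ k

listCycle-map : ∀ {m n k} (f : Vertex m → Vertex n) → (∀ x y → hamming (f x) (f y) ≡ hamming x y) →
  ListCycle m k → ListCycle n k
listCycle-map f iso (listCycle xs p c u s) = listCycle (map f xs)
  (path-map f (λ x y → trans (iso x y)) p) (trans (iso _ _) c)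
  (Unique.map⁺ (λ {x} {y} eq → hamming≡0⇒≡ x y
    (trans (sym (iso x y)) (trans (cong (hamming (f x)) (sym eq)) (hamming-refl (f x))))) u)
  (trans (List.length-map f xs) s)

-- The default `d` serves positions beyond the end, because `Cycle.v` is a total function on the
-- natural numbers.
nth : ∀ {a} {A : Set a} → A → List A → ℕ → A
nth d [] _ = d
nth d (x ∷ xs) zero = x
nth d (x ∷ xs) (suc i) = nth d xs i

nth-∈ : ∀ {a} {A : Set a} (d : A) xs {i} → i < length xs → nth d xs i ∈ xs
nth-∈ d (x ∷ xs) {zero} _ = here refl
nth-∈ d (x ∷ xs) {suc i} (s≤s lt) = there (nth-∈ d xs lt)

∈-nth : ∀ {a} {A : Set a} (d : A) {xs x} → x ∈ xs → ∃ λ i → i < length xs × nth d xs i ≡ x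
∈-nth d (here refl) = zero , s≤s z≤n , refl
∈-nth d (there x∈) with ∈-nth d x∈
... | i , lt , eq = suc i , s≤s lt , eq

nth-injective : ∀ {a} {A : Set a} (d : A) {xs} → Unique xs → ∀ i j → i < length xs → j < length xs →
  nth d xs i ≡ nth d xs j → i ≡ j
nth-injective d (_ ∷ _) zero zero _ _ _ = refl
nth-injective d (x∉ ∷ _) zero (suc j) _ (s≤s lt) eq =
  contradiction eq (All.lookup x∉ (nth-∈ d _ lt))
nth-injective d (x∉ ∷ _) (suc i) zero (s≤s lt) _ eq =
  contradiction (sym eq) (All.lookup x∉ (nth-∈ d _ lt))
nth-injective d (_ ∷ u) (suc i) (suc j) (s≤s lt) (s≤s lt′) eq =
  cong suc (nth-injective d u i j lt lt′ eq)

nth-start : ∀ {n} {u w : Vertex n} {xs} d → Path u w xs → nth d xs 0 ≡ u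
nth-start d [ _ ] = refl
nth-start d (_ ∷ _) = refl

nth-end : ∀ {n} {u w : Vertex n} {xs} d → Path u w xs → nth d xs (length xs ∸ 1) ≡ w
nth-end d [ _ ] = refl
nth-end d (_ ∷ p@([ _ ])) = nth-end d p
nth-end d (_ ∷ p@(_ ∷ _)) = nth-end d p

nth-adj : ∀ {n} {u w : Vertex n} {xs} d → Path u w xs → ∀ i → suc i < length xs →
  Adj (nth d xs i) (nth d xs (suc i))
nth-adj d [ _ ] i (s≤s ())
nth-adj {u = u} d (a ∷ p) zero _ = subst (Adj u) (sym (nth-start d p)) a
nth-adj d (_ ∷ p) (suc i) (s≤s lt) = nth-adj d p i lt

module _ {n k} (L : ListCycle n k) where
  open ListCycle L

  toCycle : Cycle n k
  toCycle = subst (Cycle n) size (record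
    { v = nth start list
    ; distinct = nth-injective start unique
    ; adjStep = nth-adj start path
    ; adjClose = subst₂ Adj (sym (nth-end start path)) (sym (nth-start start path)) close
    })

toCycle-∈⁺ : ∀ {n k} (L : ListCycle n k) {x} → x ∈ ListCycle.list L → InCycle x (toCycle L)
toCycle-∈⁺ (listCycle {u} xs _ _ _ refl) = ∈-nth u

toCycle-∈⁻ : ∀ {n k} (L : ListCycle n k) {x} → InCycle x (toCycle L) → x ∈ ListCycle.list L
toCycle-∈⁻ (listCycle {u} xs _ _ _ refl) (i , lt , refl) = nth-∈ u xs lt

zeros ones : ∀ {n} → Vertex n
zeros = replicate _ false
ones = replicate _ true

-- Out along the list in the lower half and back in the upper half, so that a path ends directly
-- above its start.
ladder : ∀ {n} → List (Vertex n) → List (Vertex (suc n))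
ladder [] = []
ladder (x ∷ xs) = (false ∷ x) ∷ ladder xs ++ (true ∷ x) ∷ []

ladder-path : ∀ {n} {u w : Vertex n} {xs} → Path u w xs → Path (false ∷ u) (true ∷ u) (ladder xs)
ladder-path [ u ] = adj-head false u ∷ [ true ∷ u ]
ladder-path {u = u} (_∷_ {w = w} a p) =
  a ∷ path-++ (ladder-path p) (adj-sym u w a) [ true ∷ u ]

∈-ladder⁻ : ∀ {n b} {x : Vertex n} xs → (b ∷ x) ∈ ladder xs → x ∈ xs
∈-ladder⁻ (x ∷ xs) (here refl) = here refl
∈-ladder⁻ (x ∷ xs) (there p) with ∈.∈-++⁻ (ladder xs) p
... | inj₁ q = there (∈-ladder⁻ xs q)
... | inj₂ (here refl) = here refl

ladder-unique : ∀ {n} {xs : List (Vertex n)} → Unique xs → Unique (ladder xs)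
ladder-unique [] = []
ladder-unique {xs = x ∷ xs} (x∉ ∷ u) =
  All.tabulate bottom ∷ Unique.++⁺ (ladder-unique u) ([] ∷ []) λ { (p , here refl) → x∉xs p }
  where
  x∉xs : ∀ {b} → (b ∷ x) ∉ ladder xs
  x∉xs p = All.lookup x∉ (∈-ladder⁻ xs p) refl
  bottom : ∀ {z} → z ∈ ladder xs ++ (true ∷ x) ∷ [] → false ∷ x ≢ z
  bottom z∈ refl with ∈.∈-++⁻ (ladder xs) z∈
  ... | inj₁ p = x∉xs p
  ... | inj₂ (here ())

length-ladder : ∀ {n} (xs : List (Vertex n)) → length (ladder xs) ≡ length xs + length xs
length-ladder [] = refl
length-ladder (x ∷ xs) = cong suc (trans (List.length-++ (ladder xs))
  (trans (ℕ.+-comm _ 1) (trans (cong suc (length-ladder xs)) (sym (ℕ.+-suc (length xs) _)))))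

-- The reflected Gray code, a Hamiltonian path of the hypercube.
gray : ∀ n → List (Vertex n)
gray zero = [] ∷ []
gray (suc n) = ladder (gray n)

gray-path : ∀ n → ∃ λ z → Path zeros z (gray n)
gray-path zero = [] , [ [] ]
gray-path (suc n) = true ∷ zeros , ladder-path (proj₂ (gray-path n))

gray-unique : ∀ n → Unique (gray n)
gray-unique zero = [] ∷ []
gray-unique (suc n) = ladder-unique (gray-unique n)

length-gray : ∀ n → length (gray n) ≡ 2 ^ n
length-gray zero = refl
length-gray (suc n) = trans (length-ladder (gray n))
  (cong₂ _+_ (length-gray n) (trans (length-gray n) (sym (ℕ.+-identityʳ _))))

lastUnit : ∀ n → Vertex (suc n)
lastUnit zero = true ∷ []
lastUnit (suc n) = false ∷ lastUnit n

lastUnit-adj-zeros : ∀ n → Adj (lastUnit n) zeros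
lastUnit-adj-zeros zero = refl
lastUnit-adj-zeros (suc n) = lastUnit-adj-zeros n

-- The path e₀, e₀+e₁, e₁, e₁+e₂, ... through all unit vectors.
zigzag : ∀ n → List (Vertex (suc n))
zigzag zero = (true ∷ []) ∷ []
zigzag (suc n) = (true ∷ zeros) ∷ (true ∷ true ∷ zeros) ∷ map (false ∷_) (zigzag n)

zigzag-path : ∀ n → Path (true ∷ zeros) (lastUnit n) (zigzag n)
zigzag-path zero = [ _ ]
zigzag-path (suc n) = adj-∷ true (false ∷ zeros {n}) (true ∷ zeros {n}) (adj-head false (zeros {n})) ∷ adj-head true (true ∷ zeros {n}) ∷
  path-map (false ∷_) (adj-∷ false) (zigzag-path n)

∉-map-∷ : ∀ {n b c} {x : Vertex n} {xs} → b ≢ c → (b ∷ x) ∉ map (c ∷_) xs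
∉-map-∷ b≢c p with ∈.∈-map⁻ _ p
... | _ , _ , refl = b≢c refl

zigzag-unique : ∀ n → Unique (zigzag n)
zigzag-unique zero = [] ∷ []
zigzag-unique (suc n) =
  ((λ ()) ∷ All.tabulate λ { z∈ refl → ∉-map-∷ (λ ()) z∈ }) ∷
  All.tabulate (λ { z∈ refl → ∉-map-∷ (λ ()) z∈ }) ∷
  Unique.map⁺ Vec.∷-injectiveʳ (zigzag-unique n)

zigzag-∌-zeros : ∀ n → zeros ∉ zigzag n
zigzag-∌-zeros zero (here ())
zigzag-∌-zeros (suc n) (there (there p)) with ∈.∈-map⁻ _ p
... | _ , q , refl = zigzag-∌-zeros n q

zigzag-∋-units : ∀ n i → flip i zeros ∈ zigzag n
zigzag-∋-units zero zero = here refl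
zigzag-∋-units (suc n) zero = here refl
zigzag-∋-units (suc n) (suc i) = there (there (∈.∈-map⁺ _ (zigzag-∋-units n i)))

length-zigzag : ∀ n → length (zigzag n) ≡ suc (n + n)
length-zigzag zero = refl
length-zigzag (suc n) = cong (λ l → suc (suc l))
  (trans (List.length-map _ (zigzag n)) (trans (length-zigzag n) (sym (ℕ.+-suc n n))))

-- A cycle through all neighbours of zeros but not through zeros: the zigzag e₂, e₂+e₃, e₃, … collects
-- all of them but e₀ and e₁. The ladder over an initial segment of a Gray code starts at e₀ and makes
-- the length adjustable.
module _ (n j : ℕ) where

  steps : List (Vertex (suc n))
  steps = ladder (take (suc j) (gray n))

  part₁ part₂ part₃ : List (Vertex (3 + n))
  part₁ = map (λ x → true ∷ false ∷ x) steps
  part₂ = map (λ x → false ∷ false ∷ x) (zigzag n)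
  -- From the last unit vector back to e₀: its sum with e₁, then e₁, then e₀+e₁.
  part₃ = (false ∷ true ∷ lastUnit n) ∷ (false ∷ true ∷ zeros) ∷ (true ∷ true ∷ zeros) ∷ []

  wheel : List (Vertex (3 + n))
  wheel = part₁ ++ part₂ ++ part₃

  ∈-wheel⁻ : ∀ {x} → x ∈ wheel → x ∈ part₁ ⊎ x ∈ part₂ ⊎ x ∈ part₃
  ∈-wheel⁻ x∈ with ∈.∈-++⁻ part₁ x∈
  ... | inj₁ p = inj₁ p
  ... | inj₂ p = inj₂ (∈.∈-++⁻ part₂ p)

  wheel-path : Path (true ∷ zeros) (true ∷ true ∷ zeros) wheel
  wheel-path = path-++
    (path-map _ (λ x y a → a) (ladder-path (proj₂ (path-take j (proj₂ (gray-path n))))))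
    (adj-head true (false ∷ true ∷ zeros {n}))
    (path-++ (path-map _ (λ x y a → a) (zigzag-path n))
      (adj-head false (lastUnit n))
      (lastUnit-adj-zeros n ∷ adj-head false (true ∷ zeros {suc n}) ∷ [ _ ]))

  wheel-close : Adj {3 + n} (true ∷ true ∷ zeros) (true ∷ zeros)
  wheel-close = adj-head true (false ∷ zeros {suc n})

  wheel-unique : Unique wheel
  wheel-unique = Unique.++⁺
    (Unique.map⁺ (Vec.∷-injectiveʳ ∘ Vec.∷-injectiveʳ)
      (ladder-unique (Unique.take⁺ (suc j) (gray-unique n))))
    (Unique.++⁺ (Unique.map⁺ (Vec.∷-injectiveʳ ∘ Vec.∷-injectiveʳ) (zigzag-unique n))
      (((λ eq → lastUnit≢zeros (Vec.∷-injectiveʳ (Vec.∷-injectiveʳ eq))) ∷ (λ ()) ∷ []) ∷ ((λ ()) ∷ []) ∷ [] ∷ [])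
      disjoint₂)
    disjoint₁
    where
    lastUnit≢zeros : lastUnit n ≢ zeros
    lastUnit≢zeros eq = contradiction
      (trans (sym (lastUnit-adj-zeros n)) (trans (cong (hamming (lastUnit n)) (sym eq)) (hamming-refl (lastUnit n)))) λ ()
    disjoint₂ : ∀ {z} → z ∈ part₂ × z ∈ part₃ → ⊥
    disjoint₂ (p , q) with ∈.∈-map⁻ _ p
    disjoint₂ (p , here ()) | _ , _ , refl
    disjoint₂ (p , there (here ())) | _ , _ , refl
    disjoint₂ (p , there (there (here ()))) | _ , _ , refl
    disjoint₁ : ∀ {z} → z ∈ part₁ × z ∈ part₂ ++ part₃ → ⊥
    disjoint₁ (p , q) with ∈.∈-map⁻ _ p | ∈.∈-++⁻ part₂ q
    ... | _ , _ , refl | inj₁ r with ∈.∈-map⁻ _ r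
    ...   | _ , _ , ()
    disjoint₁ (p , q) | _ , _ , refl | inj₂ (here ())
    disjoint₁ (p , q) | _ , _ , refl | inj₂ (there (here ()))
    disjoint₁ (p , q) | _ , _ , refl | inj₂ (there (there (here ())))

  wheel-∋-units : ∀ i → flip i zeros ∈ wheel
  wheel-∋-units zero = ∈.∈-++⁺ˡ (∈.∈-map⁺ (λ x → true ∷ false ∷ x) first)
    where
    first : zeros ∈ steps
    first = path-start-∈ (ladder-path (proj₂ (path-take j (proj₂ (gray-path n)))))
  wheel-∋-units (suc zero) = ∈.∈-++⁺ʳ part₁ (∈.∈-++⁺ʳ part₂ (there (here refl)))
  wheel-∋-units (suc (suc i)) = ∈.∈-++⁺ʳ part₁ (∈.∈-++⁺ˡ (∈.∈-map⁺ _ (zigzag-∋-units n i)))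

  wheel-∌-zeros : zeros ∉ wheel
  wheel-∌-zeros p with ∈-wheel⁻ p
  ... | inj₁ q with ∈.∈-map⁻ _ q
  ...   | _ , _ , ()
  wheel-∌-zeros p | inj₂ (inj₁ q) with ∈.∈-map⁻ _ q
  ...   | _ , r , refl = zigzag-∌-zeros n r
  wheel-∌-zeros p | inj₂ (inj₂ (here ()))
  wheel-∌-zeros p | inj₂ (inj₂ (there (here ())))
  wheel-∌-zeros p | inj₂ (inj₂ (there (there (here ()))))

  wheel-∌-ones : ones ∉ wheel
  wheel-∌-ones p with ∈-wheel⁻ p
  ... | inj₁ q with ∈.∈-map⁻ _ q
  ...   | _ , _ , ()
  wheel-∌-ones p | inj₂ (inj₁ q) with ∈.∈-map⁻ _ q
  ...   | _ , _ , ()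
  wheel-∌-ones p | inj₂ (inj₂ (here ()))
  wheel-∌-ones p | inj₂ (inj₂ (there (here ())))
  wheel-∌-ones p | inj₂ (inj₂ (there (there (here ()))))

  -- The bound on `j` makes the Gray code long enough for an initial segment of `suc j` vertices,
  -- each of which counts twice in the ladder.
  length-wheel : suc j ≤ 2 ^ n → length wheel ≡ 2 * (3 + n + j)
  length-wheel le = trans (List.length-++ part₁)
    (trans (cong₂ _+_ l₁ (trans (List.length-++ part₂)
      (cong (_+ 3) (trans (List.length-map _ (zigzag n)) (length-zigzag n))))) (arith n j))
    where
    l₀ : length (take (suc j) (gray n)) ≡ suc j
    l₀ = trans (List.length-take (suc j) (gray n))
      (ℕ.m≤n⇒m⊓n≡m (subst (suc j ≤_) (sym (length-gray n)) le))
    l₁ : length part₁ ≡ suc j + suc j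
    l₁ = trans (List.length-map _ steps) (trans (length-ladder (take (suc j) (gray n))) (cong₂ _+_ l₀ l₀))
    arith : ∀ n j → suc j + suc j + (suc (n + n) + 3) ≡ 2 * (3 + n + j)
    arith = solve-∀

  wheelCycle : suc j ≤ 2 ^ n → ListCycle (3 + n) (2 * (3 + n + j))
  wheelCycle le = listCycle wheel wheel-path wheel-close wheel-unique (length-wheel le)

-- Cut families

-- The subcube through `zeros` spanned by `k` consecutive directions from `s` on.
embed : ∀ s {k n} → s + k ≤ n → Vertex k → Vertex n
embed (suc s) (s≤s le) x = false ∷ embed s le x
embed zero {zero} _ [] = zeros
embed zero {suc k} (s≤s le) (b ∷ x) = b ∷ embed zero le x

embed-hamming : ∀ s {k n} (le : s + k ≤ n) x y → hamming (embed s le x) (embed s le y) ≡ hamming x y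
embed-hamming (suc s) (s≤s le) x y = embed-hamming s le x y
embed-hamming zero {zero} {n} _ [] [] = hamming-refl (zeros {n})
embed-hamming zero {suc k} (s≤s le) (a ∷ x) (b ∷ y) =
  trans (hamming-split a b (embed zero le x) (embed zero le y))
    (trans (cong (bitDist a b +_) (embed-hamming zero le x y)) (sym (hamming-split a b x y)))

embed-injective : ∀ s {k n} (le : s + k ≤ n) {x y} → embed s le x ≡ embed s le y → x ≡ y
embed-injective s le {x} {y} eq = hamming≡0⇒≡ x y
  (trans (sym (embed-hamming s le x y))
    (trans (cong (hamming (embed s le x)) (sym eq)) (hamming-refl (embed s le x))))

embed-zeros : ∀ s {k n} (le : s + k ≤ n) → embed s le zeros ≡ zeros
embed-zeros (suc s) (s≤s le) = cong (false ∷_) (embed-zeros s le)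
embed-zeros zero {zero} _ = refl
embed-zeros zero {suc k} (s≤s le) = cong (false ∷_) (embed-zeros zero le)

embed-unit : ∀ s {k n} (le : s + k ≤ n) (i : Fin n) → s ≤ toℕ i → toℕ i < s + k →
  ∃ λ j → embed s le (flip j zeros) ≡ flip i zeros
embed-unit (suc s) (s≤s le) (suc i) (s≤s s≤i) (s≤s i<) with embed-unit s le i s≤i i<
... | j , eq = j , cong (false ∷_) eq
embed-unit zero {suc k} (s≤s le) zero _ _ = zero , cong (true ∷_) (embed-zeros zero le)
embed-unit zero {suc k} (s≤s le) (suc i) _ (s≤s i<) with embed-unit zero le i z≤n i<
... | j , eq = suc j , cong (false ∷_) eq

embed≢ones : ∀ s {k n} (le : s + k ≤ n) x → k < n → embed s le x ≢ ones
embed≢ones (suc s) (s≤s le) x _ ()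
embed≢ones zero {zero} {suc n} _ [] _ ()
embed≢ones zero {suc k} (s≤s le) (b ∷ x) (s≤s k<n) eq = embed≢ones zero le x k<n (Vec.∷-injectiveʳ eq)

reach-remains : ∀ {n k} {F : List (Cycle n k)} {u w} → Reach F u w → Remains F u
reach-remains (here r) = r
reach-remains (step r _ _) = r

isolates-zeros : ∀ {n k} (F : List (Cycle (suc n) k)) → (∀ i → InFamily (flip i zeros) F) →
  Remains F zeros → Remains F ones → IsStructureCut F
isolates-zeros F units r₀ r₁ = inj₁ (zeros , ones , r₀ , r₁ , unreachable)
  where
  unreachable : ¬ Reach F zeros ones
  -- The empty walk is impossible since `zeros` and `ones` differ in positive dimension; any other
  -- walk starts with a step to a removed neighbour.
  unreachable (step {w = w} _ a p) with adj⇒flip zeros w a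
  ... | i , refl = reach-remains p (units i)

HasCut : ℕ → ℕ → ℕ → Set
HasCut n k c = Σ (List (Cycle n k)) λ F → IsStructureCut F × length F ≡ c

-- If half the cycle length is at least the dimension, one cycle collects all neighbours of `zeros`;
-- the ladder absorbs the excess `j`.
one-cycle-cut : ∀ n j → suc j ≤ 2 ^ n → HasCut (3 + n) (2 * (3 + n + j)) 1
one-cycle-cut n j le = toCycle L ∷ [] ,
  isolates-zeros _ (λ i → here (toCycle-∈⁺ L (wheel-∋-units n j i)))
    (λ { (here p) → wheel-∌-zeros n j (toCycle-∈⁻ L p) ; (there ()) })
    (λ { (here p) → wheel-∌-ones n j (toCycle-∈⁻ L p) ; (there ()) }) ,
  refl
  where
  L : ListCycle (3 + n) (2 * (3 + n + j))
  L = wheelCycle n j le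

hubCycle : ∀ {h} → 3 ≤ h → ∃ λ (L : ListCycle h (2 * h)) →
  (∀ i → flip i zeros ∈ ListCycle.list L) × zeros ∉ ListCycle.list L
hubCycle {suc (suc (suc h))} (s≤s (s≤s (s≤s _))) =
  listCycle (wheel h 0) (wheel-path h 0) (wheel-close h 0) (wheel-unique h 0)
    (trans (length-wheel h 0 (ℕ.m^n>0 2 h)) (cong (2 *_) (ℕ.+-identityʳ (3 + h)))) ,
  wheel-∋-units h 0 , wheel-∌-zeros h 0

-- The windows [t h, t h + h) are shifted back to fit into [0, n), so the last two may overlap.
windows-cut : ∀ {n h} c → 3 ≤ h → h < n → n ≤ c * h → HasCut n (2 * h) c
windows-cut {suc n} {h@(suc _)} c 3≤h h<n n≤ch = map window (upTo c) ,
  isolates-zeros (map window (upTo c)) units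
    (avoid λ t p → let x , x∈ , eq = window⁻ t p in
      zeros∉base (subst (_∈ ListCycle.list base)
        (sym (embed-injective (shift t) (fits t) (trans (embed-zeros (shift t) (fits t)) eq))) x∈))
    (avoid λ t p → let x , _ , eq = window⁻ t p in embed≢ones (shift t) (fits t) x h<n (sym eq)) ,
  trans (List.length-map window (upTo c)) (List.length-upTo c)
  where
  base : ListCycle h (2 * h)
  base = proj₁ (hubCycle 3≤h)
  zeros∉base : zeros ∉ ListCycle.list base
  zeros∉base = proj₂ (proj₂ (hubCycle 3≤h))
  shift : ℕ → ℕ
  shift t = (t * h) ⊓ (suc n ∸ h)
  fits : ∀ t → shift t + h ≤ suc n
  fits t = ℕ.≤-trans (ℕ.+-monoˡ-≤ h (ℕ.m⊓n≤n (t * h) (suc n ∸ h))) (ℕ.≤-reflexive (ℕ.m∸n+n≡m (ℕ.<⇒≤ h<n)))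
  windowList : ℕ → ListCycle (suc n) (2 * h)
  windowList t = listCycle-map (embed (shift t) (fits t)) (embed-hamming (shift t) (fits t)) base
  window : ℕ → Cycle (suc n) (2 * h)
  window t = toCycle (windowList t)
  window⁻ : ∀ t {w} → InCycle w (window t) → ∃ λ x → x ∈ ListCycle.list base × w ≡ embed (shift t) (fits t) x
  window⁻ t p = ∈.∈-map⁻ (embed (shift t) (fits t)) (toCycle-∈⁻ (windowList t) p)
  avoid : ∀ {w} → (∀ t → ¬ InCycle w (window t)) → Remains (map window (upTo c)) w
  avoid ¬p p with Any.satisfied (Any.map⁻ p)
  ... | t , q = ¬p t q
  units : ∀ i → InFamily (flip i zeros) (map window (upTo c))
  units i = Any.map⁺ (lose (∈.∈-upTo⁺ t<c)
    (subst (λ x → InCycle x (window t)) (proj₂ unit)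
      (toCycle-∈⁺ (windowList t) (∈.∈-map⁺ (embed (shift t) (fits t)) (proj₁ (proj₂ (hubCycle 3≤h)) (proj₁ unit))))))
    where
    t : ℕ
    t = toℕ i / h
    t<c : t < c
    t<c = m<n*o⇒m/o<n (ℕ.<-≤-trans (Fin.toℕ<n i) n≤ch)
    below : shift t ≤ toℕ i
    below = ℕ.≤-trans (ℕ.m⊓n≤m (t * h) _) (m/n*n≤m (toℕ i) h)
    above : toℕ i < shift t + h
    -- A window in its original place contains `i` by division with remainder; one shifted back ends
    -- at the last coordinate.
    above with ℕ.⊓-sel (t * h) (suc n ∸ h)
    ... | inj₁ eq rewrite eq = subst₂ _<_ (sym (m≡m%n+[m/n]*n (toℕ i) h)) (ℕ.+-comm h (t * h))
      (ℕ.+-monoˡ-< (t * h) (m%n<n (toℕ i) h))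
    ... | inj₂ eq rewrite eq = subst (toℕ i <_) (sym (ℕ.m∸n+n≡m (ℕ.<⇒≤ h<n))) (Fin.toℕ<n i)
    unit : ∃ λ j → embed (shift t) (fits t) (flip j zeros) ≡ flip i zeros
    unit = embed-unit (shift t) (fits t) i below above

square : ∀ {n} → Vertex n → ListCycle (2 + n) 4
square x = listCycle
  ((false ∷ false ∷ x) ∷ (false ∷ true ∷ x) ∷ (true ∷ true ∷ x) ∷ (true ∷ false ∷ x) ∷ [])
  (adj-head false x ∷ adj-head false (true ∷ x) ∷ adj-head true x ∷ [ true ∷ false ∷ x ])
  (adj-head true (false ∷ x))
  (((λ ()) ∷ (λ ()) ∷ (λ ()) ∷ []) ∷ ((λ ()) ∷ (λ ()) ∷ []) ∷ ((λ ()) ∷ []) ∷ [] ∷ [])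
  refl

square-∋ : ∀ {n} a b (x : Vertex n) → (a ∷ b ∷ x) ∈ ListCycle.list (square x)
square-∋ false false x = here refl
square-∋ false true x = there (here refl)
square-∋ true true x = there (there (here refl))
square-∋ true false x = there (there (there (here refl)))

square-tail : ∀ {n a b} (x : Vertex n) {y} → (a ∷ b ∷ y) ∈ ListCycle.list (square x) → y ≡ x
square-tail x (here refl) = refl
square-tail x (there (here refl)) = refl
square-tail x (there (there (here refl))) = refl
square-tail x (there (there (there (here refl)))) = refl

ones≢unit : ∀ {n} (i : Fin (2 + n)) → ones ≢ flip i zeros
ones≢unit zero ()
ones≢unit (suc i) ()

-- The cut surrounds the square on the first two coordinates.
squares-cut : ∀ n → HasCut (4 + n) 4 (2 + n)
squares-cut n = F , inj₁ (zeros , ones , outside (λ i eq → flip-≢ i zeros (sym eq)) , outside ones≢unit , unreachable) ,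
  trans (List.length-map around (allFin (2 + n))) (List.length-tabulate {n = 2 + n} (λ i → i))
  where
  around : Fin (2 + n) → Cycle (4 + n) 4
  around i = toCycle (square (flip i zeros))
  F : List (Cycle (4 + n) 4)
  F = map around (allFin (2 + n))
  outside : ∀ {a b x} → (∀ i → x ≢ flip i zeros) → Remains F (a ∷ b ∷ x)
  outside x≢ p with Any.satisfied (Any.map⁻ {xs = allFin (2 + n)} p)
  ... | i , q = x≢ i (square-tail (flip i zeros) (toCycle-∈⁻ (square (flip i zeros)) q))
  blocked : ∀ i a b → InFamily (a ∷ b ∷ flip i zeros) F
  blocked i a b = Any.map⁺ (lose (∈.∈-allFin i) (toCycle-∈⁺ (square (flip i zeros)) (square-∋ a b (flip i zeros))))
  unreachable : ∀ {a b} → ¬ Reach F (a ∷ b ∷ zeros) ones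
  unreachable {a} {b} (step {w = w} _ adj p) with adj⇒flip (a ∷ b ∷ zeros) w adj
  -- Flipping one of the first two coordinates stays inside the enclosed square; every other flip
  -- hits a removed square.
  ... | zero , refl = unreachable p
  ... | suc zero , refl = unreachable p
  ... | suc (suc i) , refl = reach-remains p (blocked i a b)

-- Ceilings, exponential estimates and the conclusion

module _ (n h : ℕ) .{{_ : NonZero h}} where

  ceil : ℕ
  ceil = (n + h ∸ 1) / h

  suc-pred-sum : suc (n + h ∸ 1) ≡ n + h
  suc-pred-sum = ℕ.m+[n∸m]≡n (ℕ.≤-trans (>-nonZero⁻¹ h) (ℕ.m≤n+m h n))

  -- With `ceil-upper` this identifies `ceil` as the least `q` with `n ≤ q * h`; later arguments use
  -- only these two facts.
  ceil-least : ∀ q → n ≤ q * h → ceil ≤ q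
  ceil-least q n≤qh = s≤s⁻¹ (m<n*o⇒m/o<n (begin
    suc (n + h ∸ 1)  ≡⟨ suc-pred-sum ⟩
    n + h            ≤⟨ ℕ.+-monoˡ-≤ h n≤qh ⟩
    q * h + h        ≡⟨ ℕ.+-comm (q * h) h ⟩
    suc q * h        ∎))
    where open ℕ.≤-Reasoning

  ceil-upper : n ≤ ceil * h
  ceil-upper = ℕ.+-cancelʳ-≤ h n (ceil * h) (begin
    n + h                             ≡⟨ sym suc-pred-sum ⟩
    suc (n + h ∸ 1)                   ≡⟨ cong suc (m≡m%n+[m/n]*n (n + h ∸ 1) h) ⟩
    suc ((n + h ∸ 1) % h) + ceil * h  ≤⟨ ℕ.+-monoˡ-≤ (ceil * h) (m%n<n (n + h ∸ 1) h) ⟩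
    h + ceil * h                      ≡⟨ ℕ.+-comm h (ceil * h) ⟩
    ceil * h + h                      ∎)
    where open ℕ.≤-Reasoning

suc≤double : ∀ {a x} → suc a ≤ x → suc (suc a) ≤ 2 * x
suc≤double {a} {x} le = begin
  1 + suc a  ≤⟨ ℕ.+-mono-≤ (ℕ.≤-trans (s≤s z≤n) le) le ⟩
  x + x      ≡⟨ cong (x +_) (sym (ℕ.+-identityʳ x)) ⟩
  2 * x      ∎
  where open ℕ.≤-Reasoning

4+d≤2^[2+d] : ∀ d → 4 + d ≤ 2 ^ (2 + d)
4+d≤2^[2+d] zero = ℕ.≤-refl
4+d≤2^[2+d] (suc d) = suc≤double (4+d≤2^[2+d] d)

6+d≤2^[3+d] : ∀ d → 6 + d ≤ 2 ^ (3 + d)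
6+d≤2^[3+d] zero = s≤s (s≤s (s≤s (s≤s (s≤s (s≤s z≤n)))))
6+d≤2^[3+d] (suc d) = suc≤double (6+d≤2^[3+d] d)

κ-4-cycles : ∀ n → KappaEq (4 + n) 4 (2 + n)
κ-4-cycles n = squares-cut n , λ F cut →
  ℕ.+-cancelʳ-≤ 2 (2 + n) (length F)
    (subst (_≤ length F + 2) (ℕ.+-comm 2 (2 + n)) (4-cycle-cut-bound (s≤s (s≤s z≤n)) F cut))

κ-long-cycles : ∀ n d → 3 + d ≤ suc n → KappaEq (3 + n) (2 ^ (3 + d)) (ceilDivPow2 (3 + n) (2 + d))
κ-long-cycles n d (s≤s 2+d≤n) = cut , λ F isCut →
  ceil-least (3 + n) h {{_}} (length F)
    (long-cycle-cut-bound (s≤s (s≤s (s≤s (ℕ.≤-trans (s≤s z≤n) 2+d≤n)))) (ℕ.≤-trans (s≤s (s≤s z≤n)) 4≤h) F isCut)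
  where
  h = 2 ^ (2 + d)
  instance
    h≢0 : NonZero h
    h≢0 = ℕ.m^n≢0 2 (2 + d)
  4≤h : 4 ≤ h
  4≤h = ℕ.≤-trans (ℕ.m≤m+n 4 d) (4+d≤2^[2+d] d)
  cut : HasCut (3 + n) (2 * h) (ceil (3 + n) h)
  -- Below the dimension the neighbours of `zeros` are shared among windows of `h` directions;
  -- otherwise a single cycle does, with excess `j`.
  cut with h ℕ.<? 3 + n
  ... | yes h<n = windows-cut (ceil (3 + n) h) (ℕ.<⇒≤ 4≤h) h<n (ceil-upper (3 + n) h)
  ... | no h≮n with ℕ.m≤n⇒∃[o]m+o≡n (ℕ.≮⇒≥ h≮n)
  ...   | j , eq = subst₂ (λ l c → HasCut (3 + n) (2 * l) c) eq (sym ceil≡1) (one-cycle-cut n j j<2^n)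
    where
    open ℕ.≤-Reasoning
    j<2^n : suc j ≤ 2 ^ n
    j<2^n = begin
      1 + j        ≤⟨ ℕ.+-monoˡ-≤ j {1} {3 + n} (s≤s z≤n) ⟩
      3 + n + j    ≡⟨ eq ⟩
      -- The exponent bound is `m ≤ n - 2` in the theorem's notation, and it makes the Gray code
      -- long enough.
      h            ≤⟨ ℕ.^-monoʳ-≤ 2 2+d≤n ⟩
      2 ^ n        ∎
    positive : 1 ≤ ceil (3 + n) h
    positive with ceil (3 + n) h | ceil-upper (3 + n) h
    ... | suc _ | _ = s≤s z≤n
    ceil≡1 : ceil (3 + n) h ≡ 1
    ceil≡1 = ℕ.≤-antisym
      (ceil-least (3 + n) h 1 (subst (3 + n ≤_) (sym (ℕ.*-identityˡ h)) (ℕ.≮⇒≥ h≮n)))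
      positive

-- The dimension is `4 + d + q` and `m` is `3 + d`, so their difference is `suc q`. By `ceil-least`
-- it suffices that the dimension is at most `q * 2 ^ (2 + d)`.
ceil<n∸m : ∀ q d → 6 ≤ 4 + d + q → 1 ≤ q → ceilDivPow2 (4 + d + q) (2 + d) < suc q
ceil<n∸m q d 6≤n 1≤q = s≤s (ceil-least (4 + d + q) (2 ^ (2 + d)) {{ℕ.m^n≢0 2 (2 + d)}} q (bound q d 6≤n 1≤q))
  where
  open ℕ.≤-Reasoning
  bound : ∀ q d → 6 ≤ 4 + d + q → 1 ≤ q → 4 + d + q ≤ q * 2 ^ (2 + d)
  -- Dimension 5 with cycles of length 8, where the strict inequality fails.
  bound 1 zero (s≤s (s≤s (s≤s (s≤s (s≤s ()))))) _
  bound 1 (suc d) _ _ = begin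
    5 + d + 1            ≡⟨ ℕ.+-comm (5 + d) 1 ⟩
    6 + d                ≤⟨ 6+d≤2^[3+d] d ⟩
    2 ^ (3 + d)          ≡⟨ sym (ℕ.*-identityˡ _) ⟩
    1 * 2 ^ (3 + d)      ∎
  bound (suc (suc p)) d _ _ = begin
    -- The first copy of `h` bounds `4 + d`, the second bounds 2, and the other `p` copies bound
    -- `p`.
    4 + d + (2 + p)      ≤⟨ ℕ.+-mono-≤ 4+d≤h (ℕ.+-mono-≤ 2≤h (ℕ.m≤m*n p h {{ℕ.m^n≢0 2 (2 + d)}})) ⟩
    h + (h + p * h)      ∎
    where
    h = 2 ^ (2 + d)
    4+d≤h : 4 + d ≤ h
    4+d≤h = 4+d≤2^[2+d] d
    2≤h : 2 ≤ h
    2≤h = ℕ.≤-trans (s≤s (s≤s z≤n)) 4+d≤h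

theorem27 : ∀ (n m : ℕ) → 4 ≤ n → 2 ≤ m → m ≤ n ∸ 2 →
    ((n ≡ 4 ⊎ n ≡ 5) ⊎ m ≡ 2 → KappaEq n (2 ^ m) (n ∸ m))
    × (6 ≤ n → 3 ≤ m →
    KappaEq n (2 ^ m) (ceilDivPow2 n (m ∸ 1)) × ceilDivPow2 n (m ∸ 1) < n ∸ m)
theorem27 n m 4≤n 2≤m m≤n∸2 = short n m 4≤n 2≤m m≤n∸2 , long n m m≤n∸2
  where
  short : ∀ n m → 4 ≤ n → 2 ≤ m → m ≤ n ∸ 2 → (n ≡ 4 ⊎ n ≡ 5) ⊎ m ≡ 2 → KappaEq n (2 ^ m) (n ∸ m)
  short (suc (suc (suc zero))) _ (s≤s (s≤s (s≤s ())))
  short _ 1 _ (s≤s ())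
  short (suc (suc (suc (suc n)))) 2 _ _ _ _ = κ-4-cycles n
  short .4 (suc (suc (suc m))) _ _ (s≤s (s≤s ())) (inj₁ (inj₁ refl))
  -- The ceiling of 5/4 equals 5 - 3, so the bound for long cycles already gives this value.
  short .5 3 _ _ _ (inj₁ (inj₂ refl)) = κ-long-cycles 2 0 ℕ.≤-refl
  short .5 (suc (suc (suc (suc m)))) _ _ (s≤s (s≤s (s≤s ()))) (inj₁ (inj₂ refl))

  long : ∀ n m → m ≤ n ∸ 2 → 6 ≤ n → 3 ≤ m →
    KappaEq n (2 ^ m) (ceilDivPow2 n (m ∸ 1)) × ceilDivPow2 n (m ∸ 1) < n ∸ m
  long (suc (suc (suc n))) (suc (suc (suc d))) m≤ 6≤n (s≤s (s≤s (s≤s _))) = κ-long-cycles n d m≤ , strict m≤ 6≤n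
    where
    strict : 3 + d ≤ suc n → 6 ≤ 3 + n → ceilDivPow2 (3 + n) (2 + d) < n ∸ d
    strict le 6≤ with ℕ.m≤n⇒∃[o]m+o≡n le
    -- `r` is the slack in `le`, so `n ∸ d` is `2 + r` and `ceil<n∸m` applies with `suc r` for `q`.
    ... | r , refl = subst₂ (λ a b → ceilDivPow2 a (2 + d) < b) (arith₁ d r) (sym (arith₂ d r))
      (ceil<n∸m (suc r) d (subst (6 ≤_) (sym (arith₁ d r)) 6≤) (s≤s z≤n))
      where
      arith₁ : ∀ d r → 4 + d + suc r ≡ 5 + d + r
      arith₁ = solve-∀
      arith₂ : ∀ d r → 2 + d + r ∸ d ≡ suc (suc r)
      arith₂ d r = trans (cong (_∸ d) (shuffle d r)) (ℕ.m+n∸m≡n d (2 + r))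
        where
        shuffle : ∀ d r → 2 + d + r ≡ d + (2 + r)
        shuffle = solve-∀
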